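{- Let $\mathbb{F}$ be a field and $n,m,p,s,r\ge1$ integers with $s\le m-1$ and $$\binom{n+p-1}{p}\ \ge\ \frac{m\binom{s+r-1}{r}}{m-s}.$$ Assume $\mathrm{char}(\mathbb{F})=0$ or $p\le \mathrm{char}(\mathbb{F})-1$, and put $k=\binom{n+p-1}{p}$. Then for every homogeneous polynomial mapping $P\in Pol^p_{hom}(\mathbb{F}^n,\mathbb{F}^m)$ outside a subset of codimension at least $1$ of $Pol^p_{hom}(\mathbb{F}^n,\mathbb{F}^m)$, the image $P(\mathbb{F}^n)$ contains a $k$-tuple of points of $\mathbb{F}^m$ that is $(s,r)$-weakly elusive.
   Context: $Pol^p_{hom}(\mathbb{F}^n,\mathbb{F}^m)$ is the vector space of homogeneous polynomial mappings $\mathbb{F}^n\to\mathbb{F}^m$ of degree $p$ (each component homogeneous of degree $p$). A subset (e.g. a tuple of points) $A\subset\mathbb{F}^m$ is $(s,r)$-weakly elusive if $A$ is not contained in the image of any homogeneous polynomial mapping $\Gamma:\mathbb{F}^s\to\mathbb{F}^m$ of degree $r$. -}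

module Defs where

open import Level using (_⊔_) renaming (suc to lsuc)
open import Algebra.Bundles using (CommutativeRing)
open import Data.Nat using (ℕ; zero; suc; _<_; _∸_)
open import Data.Fin using (Fin; quotRem) renaming (zero to fzero; suc to fsuc)
open import Data.List using (List; []; _∷_; map; concatMap; upTo; length; lookup)
open import Data.Vec using (Vec) renaming ([] to []ᵛ; _∷_ to _∷ᵛ_)
open import Data.Product using (Σ; ∃; _×_; _,_)
open import Data.Sum using (_⊎_)
open import Relation.Nullary using (¬_)
open import Relation.Binary.PropositionalEquality using (_≡_)

record Field c ℓ : Set (lsuc (c ⊔ ℓ)) where
  field
    commutativeRing : CommutativeRing c ℓ
  open CommutativeRing commutativeRing public
  field
    0≉1     : ¬ (0# ≈ 1#)
    inverse : ∀ x → ¬ (x ≈ 0#) → ∃ λ y → (x * y) ≈ 1#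

monomials : (n p : ℕ) → List (Vec ℕ n)
monomials zero zero    = []ᵛ ∷ []
monomials zero (suc p) = []
monomials (suc n) p    = concatMap (λ e → map (e ∷ᵛ_) (monomials n (p ∸ e))) (upTo (suc p))

boxExponents : (N d : ℕ) → List (Vec ℕ N)
boxExponents zero d    = []ᵛ ∷ []
boxExponents (suc N) d = concatMap (λ e → map (e ∷ᵛ_) (boxExponents N d)) (upTo (suc d))

dimHom : ℕ → ℕ → ℕ
dimHom n p = length (monomials n p)

module _ {c ℓ} (F : Field c ℓ) where
  open Field F

  natMul : ℕ → Carrier
  natMul zero    = 0#
  natMul (suc n) = 1# + natMul n

  HasCharacteristic : ℕ → Set ℓ
  HasCharacteristic ch =
    (ch ≡ 0 × (∀ j → 0 < j → ¬ (natMul j ≈ 0#)))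
    ⊎ (0 < ch × natMul ch ≈ 0# × (∀ j → 0 < j → j < ch → ¬ (natMul j ≈ 0#)))

  pow : Carrier → ℕ → Carrier
  pow x zero    = 1#
  pow x (suc e) = x * pow x e

  sumFin : (K : ℕ) → (Fin K → Carrier) → Carrier
  sumFin zero    f = 0#
  sumFin (suc K) f = f fzero + sumFin K (λ i → f (fsuc i))

  evalMono : ∀ {N} → Vec ℕ N → (Fin N → Carrier) → Carrier
  evalMono []ᵛ       x = 1#
  evalMono (e ∷ᵛ es) x = pow (x fzero) e * evalMono es (λ i → x (fsuc i))

  record HomPolyMap (n m p : ℕ) : Set c where
    constructor homPolyMap
    field
      coeff : Fin m → Fin (dimHom n p) → Carrier

  evalHom : ∀ {n m p} → HomPolyMap n m p → (Fin n → Carrier) → Fin m → Carrier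
  evalHom {n} {m} {p} P x j =
    sumFin (dimHom n p) (λ t → HomPolyMap.coeff P j t * evalMono (lookup (monomials n p) t) x)

  -- Arbitrary polynomials in N variables, with all exponents ≤ d
  -- (one coefficient per exponent vector; every polynomial arises for some d).
  record Poly (N d : ℕ) : Set c where
    constructor poly
    field
      coeffP : Fin (length (boxExponents N d)) → Carrier

  NonZeroPoly : ∀ {N d} → Poly N d → Set ℓ
  NonZeroPoly Q = ∃ λ i → ¬ (Poly.coeffP Q i ≈ 0#)

  evalPoly : ∀ {N d} → Poly N d → (Fin N → Carrier) → Carrier
  evalPoly {N} {d} Q x =
    sumFin (length (boxExponents N d)) (λ i → Poly.coeffP Q i * evalMono (lookup (boxExponents N d) i) x)

  coords : ∀ {n m p} → HomPolyMap n m p → Fin (m Data.Nat.* dimHom n p) → Carrier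
  coords {n} {m} {p} P i with quotRem (dimHom n p) i
  ... | (t , j) = HomPolyMap.coeff P j t

  WeaklyElusive : ∀ {k m} → (s r : ℕ) → (Fin k → Fin m → Carrier) → Set (c ⊔ ℓ)
  WeaklyElusive {k} {m} s r A =
    ¬ (Σ (HomPolyMap s m r) λ Γ →
         ∀ i → Σ (Fin s → Carrier) λ y → ∀ j → evalHom Γ y j ≈ A i j)

  -- "for every P outside a subset of codimension ≥ 1 of Pol^p_hom(F^n,F^m), Prop P":
  -- the exceptional set lies in the zero set of a nonzero polynomial on the
  -- coefficient space.
  GenericallyHolds : (n m p : ℕ) → (HomPolyMap n m p → Set (c ⊔ ℓ)) → Set (c ⊔ ℓ)
  GenericallyHolds n m p Prop =
    Σ ℕ λ d → Σ (Poly (m Data.Nat.* dimHom n p) d) λ Q →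
      NonZeroPoly Q × (∀ P → ¬ (evalPoly Q (coords P) ≈ 0#) → Prop P)

{-# OPTIONS --safe #-}

-- Let k be the number of monomials of degree p in n variables.  Their exponent
-- vectors, read as points of Fⁿ, are k points at which a form of degree p may be
-- prescribed arbitrarily (Lagrange interpolation on the simplex lattice; this is
-- where p < char F is needed), so the coefficients of P are linear functions of
-- its values at these points.  If all the values lie on the image of a map Γ,
-- the m k coefficients of P are therefore forms of bidegree (1, r) in the
-- coefficients of Γ and the k preimages.  There are at most m k such parameters
-- in total, and bihomogeneity saves two degrees of freedom whereas homogeneity
-- of the sought polynomial costs only one; so for large d the monomials of
-- degree d in the coefficients of P satisfy a linear relation, which is the
-- polynomial defining the exceptional set.
--
-- Equality in F need not be decidable, so all linear algebra takes place in the
-- prime subfield, where the characteristic gives a zero test.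
module Submission where

open import Defs
open import Algebra.Bundles using (CommutativeSemiring)
import Data.Nat as ℕ
import Data.Nat.Properties as ℕₚ
open import Data.Nat using (ℕ; zero; suc)
open import Data.Fin as Fin using (Fin; zero; suc; toℕ; punchIn; _≟_; combine; quotRem; quotient; remainder; finToFun; funToFin)
open import Data.Fin.Properties using (any?; punchInᵢ≢i; remQuot-combine; funToFin-finToFin; finToFun-funToFin; toℕ-injective; toℕ<n; toℕ-fromℕ<)
open import Data.List as List using (List; []; _∷_; length) renaming (lookup to lookupᴸ)
import Data.List.Relation.Unary.Any as Any
open import Data.List.Relation.Unary.Any.Properties using (lookup-index)
open import Data.Vec as Vec using (Vec; []; _∷_; lookup; zipWith; replicate; tabulate) renaming (sum to degree)
open import Data.Vec.Functional using (insertAt)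
open import Data.Vec.Functional.Properties using (insertAt-lookup; insertAt-punchIn)
open import Data.Product using (Σ; ∃; ∃₂; _×_; _,_; proj₁; proj₂)
open import Data.Sum using (_⊎_; inj₁; inj₂)
open import Data.Empty using (⊥-elim)
open import Function using (_∘_; id)
open import Level using (_⊔_)
open import Relation.Nullary using (¬_; Dec; yes; no; ¬?)
open import Relation.Nullary.Decidable using (map′; decidable-stable)
import Relation.Binary.PropositionalEquality as ≡
open ≡ using (_≡_; _≢_; _≗_)

-- Counting and enumerating exponent vectors.

module Counting where
  open import Data.Nat
  open import Data.Nat.Properties
  open import Data.Nat.Combinatorics using (_C_; nCk+nC[k+1]≡[n+1]C[k+1]; nCn≡1; nCk≡nC[n∸k])
  open import Data.List using (concatMap; applyUpTo; upTo)
  open import Data.List.Properties using (length-map; length-++)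
  open import Data.List.Membership.Propositional using (_∈_; lose; find)
  open import Data.List.Membership.Propositional.Properties using (∈-concatMap⁺; ∈-concatMap⁻; ∈-map⁺; ∈-map⁻; ∈-upTo⁺; ∈-upTo⁻; ∈-lookup)
  open import Data.List.Relation.Unary.All as All using ()
  import Data.List.Relation.Unary.All.Properties as Allₚ
  import Data.List.Relation.Unary.AllPairs.Properties as AllPairsₚ
  open import Data.List.Relation.Unary.AllPairs using (_∷_; [])
  open import Data.List.Relation.Unary.Unique.Propositional using (Unique)
  import Data.List.Relation.Unary.Unique.Propositional.Properties as Uniqueₚ
  open import Data.Vec.Properties using (∷-injectiveˡ; ∷-injectiveʳ; lookup∘tabulate; tabulate-cong; tabulate∘lookup)
  open ≡ using (refl; sym; trans; cong; cong₂; module ≡-Reasoning)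

  -- Two separate enumerations `h` and `h′` allow a list starting at `1` to be compared with one
  -- starting at `0`, as the Pascal recursion below requires.
  length-concatMap-applyUpTo : ∀ {A : Set} (f g : ℕ → List A) (h h′ : ℕ → ℕ) q →
    (∀ i → length (f (h i)) ≡ length (g (h′ i))) →
    length (concatMap f (applyUpTo h q)) ≡ length (concatMap g (applyUpTo h′ q))
  length-concatMap-applyUpTo f g h h′ zero    eq = refl
  length-concatMap-applyUpTo f g h h′ (suc q) eq = begin
    length (f (h 0) List.++ concatMap f (applyUpTo (h ∘ suc) q))
      ≡⟨ length-++ (f (h 0)) ⟩
    length (f (h 0)) + length (concatMap f (applyUpTo (h ∘ suc) q))
      ≡⟨ cong₂ _+_ (eq 0) (length-concatMap-applyUpTo f g (h ∘ suc) (h′ ∘ suc) q (eq ∘ suc)) ⟩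
    length (g (h′ 0)) + length (concatMap g (applyUpTo (h′ ∘ suc) q))
      ≡⟨ length-++ (g (h′ 0)) ⟨
    length (g (h′ 0) List.++ concatMap g (applyUpTo (h′ ∘ suc) q)) ∎
    where open ≡-Reasoning

  dimHom-zero : ∀ n → dimHom n 0 ≡ 1
  dimHom-zero zero    = refl
  dimHom-zero (suc n) = begin
    length (List.map (0 ∷_) (monomials n 0) List.++ [])     ≡⟨ length-++ (List.map (0 ∷_) (monomials n 0)) ⟩
    length (List.map (0 ∷_) (monomials n 0)) + 0            ≡⟨ +-identityʳ _ ⟩
    length (List.map (0 ∷_) (monomials n 0))                ≡⟨ length-map (0 ∷_) (monomials n 0) ⟩
    dimHom n 0                                              ≡⟨ dimHom-zero n ⟩
    1 ∎
    where open ≡-Reasoning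

  -- Either the first exponent is `0` and the first variable drops out, or it is positive and
  -- lowering it by one leaves a monomial of degree `p`.
  dimHom-suc : ∀ n p → dimHom (suc n) (suc p) ≡ dimHom n (suc p) + dimHom (suc n) p
  dimHom-suc n p = begin
    length (f 0 List.++ concatMap f (applyUpTo suc (suc p)))
      ≡⟨ length-++ (f 0) ⟩
    length (f 0) + length (concatMap f (applyUpTo suc (suc p)))
      ≡⟨ cong₂ _+_ (length-map (0 ∷_) (monomials n (suc p)))
           (length-concatMap-applyUpTo f g suc id (suc p)
             (λ i → trans (length-map (suc i ∷_) (monomials n (p ∸ i))) (sym (length-map (i ∷_) (monomials n (p ∸ i)))))) ⟩
    dimHom n (suc p) + dimHom (suc n) p ∎
    where
    open ≡-Reasoning
    f g : ℕ → List (Vec ℕ (suc n))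
    f e = List.map (e ∷_) (monomials n (suc p ∸ e))
    g e = List.map (e ∷_) (monomials n (p ∸ e))

  -- Both sides obey Pascal's rule. Writing the number of variables as `suc n` avoids the truncated
  -- subtraction in `n + p ∸ 1`.
  dimHom≡C : ∀ n p → dimHom (suc n) p ≡ (n + p) C p
  dimHom≡C n zero = trans (dimHom-zero (suc n)) (sym (trans (nCk≡nC[n∸k] {0} {n + 0} z≤n) (nCn≡1 (n + 0))))
  dimHom≡C zero (suc p) = begin
    dimHom 1 (suc p)  ≡⟨ dimHom-suc 0 p ⟩
    dimHom 1 p        ≡⟨ dimHom≡C 0 p ⟩
    p C p             ≡⟨ nCn≡1 p ⟩
    1                 ≡⟨ nCn≡1 (suc p) ⟨
    suc p C suc p     ∎
    where open ≡-Reasoning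
  dimHom≡C (suc n) (suc p) = begin
    dimHom (2 + n) (suc p)                       ≡⟨ dimHom-suc (suc n) p ⟩
    dimHom (suc n) (suc p) + dimHom (2 + n) p    ≡⟨ cong₂ _+_ (dimHom≡C n (suc p)) (dimHom≡C (suc n) p) ⟩
    (n + suc p) C suc p + (suc n + p) C p        ≡⟨ +-comm _ ((suc n + p) C p) ⟩
    (suc n + p) C p + (n + suc p) C suc p        ≡⟨ cong (λ z → (suc n + p) C p + z C suc p) (+-suc n p) ⟩
    (suc n + p) C p + (suc n + p) C suc p        ≡⟨ nCk+nC[k+1]≡[n+1]C[k+1] (suc n + p) p ⟩
    suc (suc n + p) C suc p                      ≡⟨ cong (λ z → suc z C suc p) (+-suc n p) ⟨
    (suc n + suc p) C suc p                      ∎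
    where open ≡-Reasoning

  dimHom-positive : ∀ n p → 1 ≤ n → 1 ≤ dimHom n p
  dimHom-positive (suc n) zero    1≤n = ≤-reflexive (sym (dimHom-zero (suc n)))
  dimHom-positive (suc n) (suc p) 1≤n = ≤-trans (dimHom-positive (suc n) p 1≤n)
    (≤-trans (m≤n+m _ _) (≤-reflexive (sym (dimHom-suc n p))))

  ∈-monomials⁺ : ∀ {n p} (v : Vec ℕ n) → degree v ≡ p → v ∈ monomials n p
  ∈-monomials⁺ {zero}  []       refl = Any.here refl
  ∈-monomials⁺ {suc n} (e ∷ v)  refl =
    ∈-concatMap⁺ (λ e′ → List.map (e′ ∷_) (monomials n (e + degree v ∸ e′)))
      (lose (∈-upTo⁺ (s≤s (m≤m+n e (degree v))))
            (∈-map⁺ (e ∷_) (∈-monomials⁺ v (sym (m+n∸m≡n e (degree v))))))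

  ∈-monomials⁻ : ∀ {n p} {v : Vec ℕ n} → v ∈ monomials n p → degree v ≡ p
  ∈-monomials⁻ {zero}  {zero}  {[]} _  = refl
  ∈-monomials⁻ {zero}  {suc p}      ()
  ∈-monomials⁻ {suc n} {p} v∈
    with e , e∈ , v∈e ← find (∈-concatMap⁻ (λ e → List.map (e ∷_) (monomials n (p ∸ e))) {xs = upTo (suc p)} v∈)
    with w , w∈ , refl ← ∈-map⁻ (e ∷_) v∈e
    = trans (cong (e +_) (∈-monomials⁻ w∈)) (m+[n∸m]≡n (s≤s⁻¹ (∈-upTo⁻ e∈)))

  degree-lookup-monomials : ∀ {n p} t → degree (List.lookup (monomials n p) t) ≡ p
  degree-lookup-monomials {n} {p} t = ∈-monomials⁻ (∈-lookup {xs = monomials n p} t)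

  monomials-unique : ∀ n p → Unique (monomials n p)
  monomials-unique zero    zero    = All.[] ∷ []
  monomials-unique zero    (suc p) = []
  monomials-unique (suc n) p = Uniqueₚ.concat⁺
    (Allₚ.map⁺ (Allₚ.applyUpTo⁺₂ id (suc p) (λ e → Uniqueₚ.map⁺ ∷-injectiveʳ (monomials-unique n (p ∸ e)))))
    -- Different blocks are disjoint because their vectors differ in the first entry.
    (AllPairsₚ.map⁺ (AllPairsₚ.applyUpTo⁺₁ id (suc p) λ i<j _ (v∈i , v∈j) →
      let _ , _ , v≡i = ∈-map⁻ _ v∈i
          _ , _ , v≡j = ∈-map⁻ _ v∈j
      in <⇒≢ i<j (∷-injectiveˡ (trans (sym v≡i) v≡j))))

  lookup-injective : ∀ {A : Set} {xs : List A} → Unique xs → ∀ i j → List.lookup xs i ≡ List.lookup xs j → i ≡ j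
  lookup-injective (_ ∷ u)  Fin.zero    Fin.zero    eq = refl
  lookup-injective (x∉ ∷ u) Fin.zero    (Fin.suc j) eq = ⊥-elim (All.lookup x∉ (∈-lookup j) eq)
  lookup-injective (x∉ ∷ u) (Fin.suc i) Fin.zero    eq = ⊥-elim (All.lookup x∉ (∈-lookup i) (sym eq))
  lookup-injective (_ ∷ u)  (Fin.suc i) (Fin.suc j) eq = cong Fin.suc (lookup-injective u i j eq)

  ∈-boxExponents⁺ : ∀ {N d} (v : Vec ℕ N) → degree v ≤ d → v ∈ boxExponents N d
  ∈-boxExponents⁺ []      _ = Any.here refl
  ∈-boxExponents⁺ {suc N} {d} (e ∷ v) le =
    ∈-concatMap⁺ (λ e → List.map (e ∷_) (boxExponents N d))
      (lose (∈-upTo⁺ (s≤s (m+n≤o⇒m≤o e le)))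
            (∈-map⁺ (e ∷_) (∈-boxExponents⁺ v (m+n≤o⇒n≤o e le))))

  -- Exponent vectors in suc N variables whose last N entries are ≤ e and whose
  -- first entry brings the degree up to d (provided the others do not exceed it).
  completedExponent : ∀ d e N → Fin (suc e ^ N) → Vec ℕ (suc N)
  completedExponent d e N i = (d ∸ degree v) ∷ v
    where v = tabulate (toℕ ∘ finToFun {suc e} {N} i)

  -- The tail alone determines `i`: its entries are the digits of `i` in base `suc e`.
  completedExponent-injective : ∀ d e N i j → completedExponent d e N i ≡ completedExponent d e N j → i ≡ j
  completedExponent-injective d e N i j eq = begin
    i                                      ≡⟨ funToFin-finToFin {N} {suc e} i ⟨
    funToFin (finToFun {suc e} {N} i)      ≡⟨ funToFin-cong (λ l → toℕ-injective (entries l)) ⟩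
    funToFin (finToFun {suc e} {N} j)      ≡⟨ funToFin-finToFin {N} {suc e} j ⟩
    j                                      ∎
    where
    open ≡-Reasoning
    entries : ∀ l → toℕ (finToFun {suc e} {N} i l) ≡ toℕ (finToFun {suc e} {N} j l)
    entries l = begin
      toℕ (finToFun {suc e} {N} i l)                                    ≡⟨ lookup∘tabulate _ l ⟨
      Vec.lookup (tabulate (toℕ ∘ finToFun {suc e} {N} i)) l            ≡⟨ cong (λ v → Vec.lookup v l) (∷-injectiveʳ eq) ⟩
      Vec.lookup (tabulate (toℕ ∘ finToFun {suc e} {N} j)) l            ≡⟨ lookup∘tabulate _ l ⟩
      toℕ (finToFun {suc e} {N} j l)                                    ∎
    funToFin-cong : ∀ {m n} {f g : Fin m → Fin n} → f ≗ g → funToFin f ≡ funToFin g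
    funToFin-cong {zero}  f≗g = refl
    funToFin-cong {suc m} f≗g = cong₂ Fin.combine (f≗g Fin.zero) (funToFin-cong (f≗g ∘ Fin.suc))

  degree-tabulate-≤ : ∀ {N} (f : Fin N → ℕ) e → (∀ l → f l ≤ e) → degree (tabulate f) ≤ N * e
  degree-tabulate-≤ {zero}  f e f≤e = z≤n
  degree-tabulate-≤ {suc N} f e f≤e = +-mono-≤ (f≤e Fin.zero) (degree-tabulate-≤ (f ∘ Fin.suc) e (f≤e ∘ Fin.suc))

  degree-completedExponent : ∀ {d} e N i → N * e ≤ d → degree (completedExponent d e N i) ≡ d
  degree-completedExponent {d} e N i Ne≤d = m∸n+n≡m
    (≤-trans (degree-tabulate-≤ _ e (λ l → s≤s⁻¹ (toℕ<n (finToFun {suc e} {N} i l)))) Ne≤d)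

  lookup≤degree : ∀ {N} (w : Vec ℕ N) l → Vec.lookup w l ≤ degree w
  lookup≤degree (x ∷ w) Fin.zero    = m≤m+n x _
  lookup≤degree (x ∷ w) (Fin.suc l) = ≤-trans (lookup≤degree w l) (m≤n+m _ x)

  -- No entry exceeds the degree, so digits up to `degree v` reach every tail, and the first entry
  -- is then forced.
  completedExponent-surjective : ∀ N (v : Vec ℕ (suc N)) →
    ∃ λ i → completedExponent (degree v) (degree v) N i ≡ v
  completedExponent-surjective N (e ∷ v) = i , cong₂ _∷_ first rest
    where
    f : Fin N → Fin (suc (e + degree v))
    f l = Fin.fromℕ< (s≤s (≤-trans (lookup≤degree v l) (m≤n+m (degree v) e)))
    i : Fin (suc (e + degree v) ^ N)
    i = funToFin f
    rest : tabulate (toℕ ∘ finToFun {suc (e + degree v)} {N} i) ≡ v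
    rest = trans (tabulate-cong (λ l → trans (cong toℕ (finToFun-funToFin f l)) (toℕ-fromℕ< _))) (tabulate∘lookup v)
    first : e + degree v ∸ degree (tabulate (toℕ ∘ finToFun {suc (e + degree v)} {N} i)) ≡ e
    first = trans (cong (λ w → e + degree v ∸ degree w) rest) (m+n∸n≡m e (degree v))

  [m*n]^o : ∀ m n o → (m * n) ^ o ≡ m ^ o * n ^ o
  [m*n]^o m n zero    = refl
  [m*n]^o m n (suc o) = trans (cong (m * n *_) ([m*n]^o m n o)) ([m*n]*[o*p]≡[m*o]*[n*p] m n (m ^ o) (n ^ o))

  -- The left side grows like e ^ (a + b), the right side like e ^ N.
  enough-monomials : ∀ a b r N → a + b < N →
    ∃ λ e → suc (N * e) ^ a * suc (N * e * r) ^ b < suc e ^ N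
  enough-monomials a b r N a+b<N = e , (begin-strict
    suc (N * e) ^ a * suc (N * e * r) ^ b    ≤⟨ *-mono-≤ (^-monoˡ-≤ a bound₁) (^-monoˡ-≤ b bound₂) ⟩
    (c * suc e) ^ a * (c * suc e) ^ b        ≡⟨ ^-distribˡ-+-* (c * suc e) a b ⟨
    (c * suc e) ^ (a + b)                    ≡⟨ [m*n]^o c (suc e) (a + b) ⟩
    e * suc e ^ (a + b)                      <⟨ *-monoˡ-< (suc e ^ (a + b)) {{m^n≢0 (suc e) (a + b)}} (n<1+n e) ⟩
    suc e ^ suc (a + b)                      ≤⟨ ^-monoʳ-≤ (suc e) a+b<N ⟩
    suc e ^ N                                ∎)
    where
    open ≤-Reasoning
    -- Both bases are at most `c * suc e`. With `e = c ^ (a + b)` the accumulated constant is `e`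
    -- itself, which the one spare factor `suc e` on the right beats.
    c = suc N * suc r
    e = c ^ (a + b)
    bound₂ : suc (N * e * r) ≤ c * suc e
    bound₂ = begin
      suc (N * e * r)          ≡⟨ cong suc (trans (*-assoc N e r) (trans (cong (N *_) (*-comm e r)) (sym (*-assoc N r e)))) ⟩
      1 + N * r * e            ≤⟨ +-mono-≤ (s≤s (z≤n {r + N * suc r})) (*-monoˡ-≤ e (*-mono-≤ (n≤1+n N) (n≤1+n r))) ⟩
      c + c * e                ≡⟨ *-suc c e ⟨
      c * suc e                ∎
    bound₁ : suc (N * e) ≤ c * suc e
    bound₁ = begin
      1 + N * e                ≤⟨ +-mono-≤ (s≤s (z≤n {r + N * suc r})) (*-monoˡ-≤ e (≤-trans (n≤1+n N) (m≤m*n (suc N) (suc r)))) ⟩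
      c + c * e                ≡⟨ *-suc c e ⟨
      c * suc e                ∎

  -- If every entry of `b` were at least that of `a`, the degree bound would force equality. This
  -- supplies the vanishing factor of a Lagrange polynomial at a foreign lattice point.
  smaller-entry : ∀ {n} (a b : Vec ℕ n) → degree b ≤ degree a → a ≢ b → ∃ λ l → Vec.lookup b l < Vec.lookup a l
  smaller-entry []      []      _  ne = ⊥-elim (ne refl)
  smaller-entry (x ∷ a) (y ∷ b) le ne with y <? x
  ... | yes y<x = Fin.zero , y<x
  ... | no  y≮x with x ℕ.≟ y
  ...   | yes refl = let l , lt = smaller-entry a b (+-cancelˡ-≤ x _ _ le) (ne ∘ cong (x ∷_)) in Fin.suc l , lt
  -- Here `x < y`, so the tail of `b` has strictly smaller degree than that of `a`; in particular
  -- the tails differ.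
  ...   | no  x≢y  = let l , lt = smaller-entry a b (<⇒≤ b<a) (λ { refl → <⇒≢ b<a refl }) in Fin.suc l , lt
    where
    b<a : degree b < degree a
    b<a = +-cancelˡ-< x _ _ (<-≤-trans (+-monoˡ-< (degree b) (≤∧≢⇒< (≮⇒≥ y≮x) x≢y)) le)

open Counting

-- Subtraction-free identities of commutative semirings.

module SemiringIdentities {c ℓ} (R : CommutativeSemiring c ℓ) where
  open CommutativeSemiring R hiding (zero)
  open import Algebra.Solver.Ring.NaturalCoefficients.Default R using (solve; _:+_; _:*_; _:=_)

  xz*y≈z*xy : ∀ x z y → x * z * y ≈ z * (x * y)
  xz*y≈z*xy = solve 3 (λ x z y → x :* z :* y := z :* (x :* y)) refl

  -- For `x = (a - b) / d` the numerator `a` appears as `x * d + b`; this and the next identity are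
  -- addition and multiplication of such fractions with denominators cleared.
  sum-of-fractions : ∀ x y d d′ b b′ →
    (x + y) * (d * d′) + (b * d′ + b′ * d) ≈ (x * d + b) * d′ + (y * d′ + b′) * d
  sum-of-fractions = solve 6 (λ x y d d′ b b′ → (x :+ y) :* (d :* d′) :+ (b :* d′ :+ b′ :* d)
    := (x :* d :+ b) :* d′ :+ (y :* d′ :+ b′) :* d) refl

  product-of-fractions : ∀ x y d d′ b b′ →
    x * y * (d * d′) + ((x * d + b) * b′ + b * (y * d′ + b′)) ≈ (x * d + b) * (y * d′ + b′) + b * b′
  product-of-fractions = solve 6 (λ x y d d′ b b′ → x :* y :* (d :* d′) :+ ((x :* d :+ b) :* b′ :+ b :* (y :* d′ :+ b′))
    := (x :* d :+ b) :* (y :* d′ :+ b′) :+ b :* b′) refl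

  y[xd+b]≈xyd+yb : ∀ x y d b → y * (x * d + b) ≈ x * y * d + y * b
  y[xd+b]≈xyd+yb = solve 4 (λ x y d b → y :* (x :* d :+ b) := x :* y :* d :+ y :* b) refl

  ya+[yq+d]≈d+y[a+q] : ∀ y a q d → y * a + (y * q + d) ≈ d + y * (a + q)
  ya+[yq+d]≈d+y[a+q] = solve 4 (λ y a q d → y :* a :+ (y :* q :+ d) := d :+ y :* (a :+ q)) refl

  -- The variable `n` is later instantiated by a negated scalar, so that no subtraction has to be
  -- normalised.
  n[av]+b[αv]≈[αb+na]v : ∀ n a v b α → n * (a * v) + b * (α * v) ≈ (α * b + n * a) * v
  n[av]+b[αv]≈[αb+na]v = solve 5 (λ n a v b α → n :* (a :* v) :+ b :* (α :* v) := (α :* b :+ n :* a) :* v) refl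

  [ab][cd]≈[ac][bd] : ∀ a b c d → (a * b) * (c * d) ≈ (a * c) * (b * d)
  [ab][cd]≈[ac][bd] = solve 4 (λ a b c d → (a :* b) :* (c :* d) := (a :* c) :* (b :* d)) refl

  x[ay]≈a[xy] : ∀ x a y → x * (a * y) ≈ a * (x * y)
  x[ay]≈a[xy] = solve 3 (λ x a y → x :* (a :* y) := a :* (x :* y)) refl

  y[x+q]+ny≈[x+n]y+yq : ∀ y x q n → y * (x + q) + n * y ≈ (x + n) * y + y * q
  y[x+q]+ny≈[x+n]y+yq = solve 4 (λ y x q n → y :* (x :+ q) :+ n :* y := (x :+ n) :* y :+ y :* q) refl

-- Finite sums, cancellation and natural multiples of one.

module FieldLemmas {c ℓ} (F : Field c ℓ) where
  open Field F public hiding (zero)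
  open import Algebra.Properties.Ring ring public using (-‿distribˡ-*; -‿distribʳ-*; +-cancelˡ; +-cancelʳ; +-inverseˡ-unique)
  open import Algebra.Properties.Semiring.Sum semiring public
  open SemiringIdentities commutativeSemiring public
  open import Relation.Binary.Reasoning.Setoid setoid public

  infix 4 _≉0
  _≉0 : Carrier → Set ℓ
  x ≉0 = ¬ (x ≈ 0#)

  ι : ℕ → Carrier
  ι = natMul F

  sumFin≡sum : ∀ {n} (f : Fin n → Carrier) → sumFin F n f ≡ sum f
  sumFin≡sum {zero}  f = ≡.refl
  sumFin≡sum {suc n} f = ≡.cong (f zero +_) (sumFin≡sum (f ∘ suc))

  sum-cong : ∀ {n} {f g : Fin n → Carrier} → (∀ i → f i ≈ g i) → sum f ≈ sum g
  sum-cong = sum-cong-≋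

  sum-zero : ∀ {n} {f : Fin n → Carrier} → (∀ i → f i ≈ 0#) → sum f ≈ 0#
  sum-zero {n} f≈0 = trans (sum-cong f≈0) (sum-replicate-zero n)

  sum-single : ∀ {n} (f : Fin n → Carrier) i → (∀ j → j ≢ i → f j ≈ 0#) → sum f ≈ f i
  sum-single {suc n} f i zeros = begin
    sum f                                   ≈⟨ sum-remove {i = i} f ⟩
    f i + sum (λ j → f (punchIn i j))       ≈⟨ +-congˡ (sum-zero (λ j → zeros _ (punchInᵢ≢i i j))) ⟩
    f i + 0#                                ≈⟨ +-identityʳ _ ⟩
    f i                                     ∎

  -- Without decidable equality a vanishing product gives no disjunction; one factor has to be known
  -- nonzero so that it can be inverted.
  x*y≈0⇒y≈0 : ∀ {x y} → x ≉0 → x * y ≈ 0# → y ≈ 0#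
  x*y≈0⇒y≈0 {x} {y} x≉0 xy≈0 with x⁻¹ , xx⁻¹≈1 ← inverse x x≉0 = begin
    y               ≈⟨ *-identityˡ y ⟨
    1# * y          ≈⟨ *-congʳ xx⁻¹≈1 ⟨
    x * x⁻¹ * y     ≈⟨ xz*y≈z*xy x x⁻¹ y ⟩
    x⁻¹ * (x * y)   ≈⟨ *-congˡ xy≈0 ⟩
    x⁻¹ * 0#        ≈⟨ zeroʳ x⁻¹ ⟩
    0#              ∎

  *-≉0 : ∀ {x y} → x ≉0 → y ≉0 → x * y ≉0
  *-≉0 x≉0 y≉0 xy≈0 = y≉0 (x*y≈0⇒y≈0 x≉0 xy≈0)

  *-cancelʳ : ∀ {x y z} → z ≉0 → x * z ≈ y * z → x ≈ y
  *-cancelʳ {x} {y} {z} z≉0 eq with z⁻¹ , zz⁻¹≈1 ← inverse z z≉0 = begin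
    x               ≈⟨ *-identityʳ x ⟨
    x * 1#          ≈⟨ *-congˡ zz⁻¹≈1 ⟨
    x * (z * z⁻¹)   ≈⟨ *-assoc x z z⁻¹ ⟨
    x * z * z⁻¹     ≈⟨ *-congʳ eq ⟩
    y * z * z⁻¹     ≈⟨ *-assoc y z z⁻¹ ⟩
    y * (z * z⁻¹)   ≈⟨ *-congˡ zz⁻¹≈1 ⟩
    y * 1#          ≈⟨ *-identityʳ y ⟩
    y               ∎

  1≉0 : 1# ≉0
  1≉0 = 0≉1 ∘ sym

  ι-+ : ∀ a b → ι (a ℕ.+ b) ≈ ι a + ι b
  ι-+ zero    b = sym (+-identityˡ (ι b))
  ι-+ (suc a) b = trans (+-congˡ (ι-+ a b)) (sym (+-assoc 1# (ι a) (ι b)))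

  ι-* : ∀ a b → ι (a ℕ.* b) ≈ ι a * ι b
  ι-* zero    b = sym (zeroˡ (ι b))
  ι-* (suc a) b = begin
    ι (b ℕ.+ a ℕ.* b)     ≈⟨ ι-+ b (a ℕ.* b) ⟩
    ι b + ι (a ℕ.* b)     ≈⟨ +-cong (sym (*-identityˡ (ι b))) (ι-* a b) ⟩
    1# * ι b + ι a * ι b  ≈⟨ distribʳ (ι b) 1# (ι a) ⟨
    ι (suc a) * ι b       ∎

  ι-∸ : ∀ {a b} → a ℕ.≤ b → ι b ≈ ι a + ι (b ℕ.∸ a)
  ι-∸ {a} {b} a≤b = trans (reflexive (≡.cong ι (≡.sym (ℕₚ.m+[n∸m]≡n a≤b)))) (ι-+ a (b ℕ.∸ a))

  -- In positive characteristic `ι j` depends only on `j` modulo `ch`, and minimality of `ch` makes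
  -- every nonzero remainder survive.
  ι≟0 : ∀ {ch} → HasCharacteristic F ch → ∀ j → Dec (ι j ≈ 0#)
  ι≟0 (inj₁ (_ , char0)) zero    = yes refl
  ι≟0 (inj₁ (_ , char0)) (suc j) = no (char0 (suc j) (ℕ.s≤s ℕ.z≤n))
  ι≟0 {suc ch} (inj₂ (_ , ch≈0 , minimal)) j = decide (j % suc ch) (m%n<n j (suc ch)) ≡.refl
    where
    open import Data.Nat.DivMod using (_%_; _/_; m%n<n; m≡m%n+[m/n]*n)
    ι-% : ι j ≈ ι (j % suc ch)
    ι-% = begin
      ι j                                                 ≡⟨ ≡.cong ι (m≡m%n+[m/n]*n j (suc ch)) ⟩
      ι (j % suc ch ℕ.+ (j / suc ch) ℕ.* suc ch)          ≈⟨ ι-+ (j % suc ch) _ ⟩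
      ι (j % suc ch) + ι ((j / suc ch) ℕ.* suc ch)        ≈⟨ +-congˡ (ι-* (j / suc ch) (suc ch)) ⟩
      ι (j % suc ch) + ι (j / suc ch) * ι (suc ch)        ≈⟨ +-congˡ (trans (*-congˡ ch≈0) (zeroʳ _)) ⟩
      ι (j % suc ch) + 0#                                 ≈⟨ +-identityʳ _ ⟩
      ι (j % suc ch)                                      ∎
    decide : ∀ q → q ℕ.< suc ch → j % suc ch ≡ q → Dec (ι j ≈ 0#)
    decide zero    _   eq = yes (trans ι-% (reflexive (≡.cong ι eq)))
    decide (suc q) q<  eq = no λ j≈0 → minimal (suc q) (ℕ.s≤s ℕ.z≤n) q<
                              (trans (sym (trans ι-% (reflexive (≡.cong ι eq)))) j≈0)

-- The prime subfield and its zero test.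

module PrimeSubfield {c ℓ} (F : Field c ℓ) (ι≟0 : ∀ j → Dec (Field._≈_ F (natMul F j) (Field.0# F))) where
  open FieldLemmas F hiding (ι≟0)

  -- x lies in the prime subfield: x = (a - b) / d with natural numbers a, b, d.
  InPrimeField : Carrier → Set ℓ
  InPrimeField x = ∃ λ a → ∃₂ λ b d → ι d ≉0 × x * ι d + ι b ≈ ι a

  inPrimeField-resp : ∀ {x y} → x ≈ y → InPrimeField x → InPrimeField y
  inPrimeField-resp x≈y (a , b , d , d≉0 , eq) = a , b , d , d≉0 , trans (+-congʳ (*-congʳ (sym x≈y))) eq

  inPrimeField-ι : ∀ a → InPrimeField (ι a)
  inPrimeField-ι a = a , 0 , 1 , (λ eq → 1≉0 (trans (sym (+-identityʳ 1#)) eq))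
            , trans (+-identityʳ _) (trans (*-congˡ (+-identityʳ 1#)) (*-identityʳ (ι a)))

  inPrimeField-0 : InPrimeField 0#
  inPrimeField-0 = inPrimeField-ι 0

  inPrimeField-1 : InPrimeField 1#
  inPrimeField-1 = inPrimeField-resp (+-identityʳ 1#) (inPrimeField-ι 1)

  inPrimeField-+ : ∀ {x y} → InPrimeField x → InPrimeField y → InPrimeField (x + y)
  inPrimeField-+ {x} {y} (a , b , d , d≉0 , eq) (a′ , b′ , d′ , d′≉0 , eq′) =
    a ℕ.* d′ ℕ.+ a′ ℕ.* d , b ℕ.* d′ ℕ.+ b′ ℕ.* d , d ℕ.* d′ ,
    (λ dd′≈0 → *-≉0 d≉0 d′≉0 (trans (sym (ι-* d d′)) dd′≈0)) , (begin
      (x + y) * ι (d ℕ.* d′) + ι (b ℕ.* d′ ℕ.+ b′ ℕ.* d)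
        ≈⟨ +-cong (*-congˡ (ι-* d d′)) (trans (ι-+ (b ℕ.* d′) _) (+-cong (ι-* b d′) (ι-* b′ d))) ⟩
      (x + y) * (ι d * ι d′) + (ι b * ι d′ + ι b′ * ι d)
        ≈⟨ sum-of-fractions x y (ι d) (ι d′) (ι b) (ι b′) ⟩
      (x * ι d + ι b) * ι d′ + (y * ι d′ + ι b′) * ι d
        ≈⟨ +-cong (*-congʳ eq) (*-congʳ eq′) ⟩
      ι a * ι d′ + ι a′ * ι d
        ≈⟨ trans (ι-+ (a ℕ.* d′) _) (+-cong (ι-* a d′) (ι-* a′ d)) ⟨
      ι (a ℕ.* d′ ℕ.+ a′ ℕ.* d) ∎)

  inPrimeField-* : ∀ {x y} → InPrimeField x → InPrimeField y → InPrimeField (x * y)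
  inPrimeField-* {x} {y} (a , b , d , d≉0 , eq) (a′ , b′ , d′ , d′≉0 , eq′) =
    a ℕ.* a′ ℕ.+ b ℕ.* b′ , a ℕ.* b′ ℕ.+ b ℕ.* a′ , d ℕ.* d′ ,
    (λ dd′≈0 → *-≉0 d≉0 d′≉0 (trans (sym (ι-* d d′)) dd′≈0)) , (begin
      x * y * ι (d ℕ.* d′) + ι (a ℕ.* b′ ℕ.+ b ℕ.* a′)
        ≈⟨ +-cong (*-congˡ (ι-* d d′)) (trans (ι-+ (a ℕ.* b′) _) (+-cong (ι-* a b′) (ι-* b a′))) ⟩
      x * y * (ι d * ι d′) + (ι a * ι b′ + ι b * ι a′)
        ≈⟨ +-congˡ (+-cong (*-congʳ (sym eq)) (*-congˡ (sym eq′))) ⟩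
      x * y * (ι d * ι d′) + ((x * ι d + ι b) * ι b′ + ι b * (y * ι d′ + ι b′))
        ≈⟨ product-of-fractions x y (ι d) (ι d′) (ι b) (ι b′) ⟩
      (x * ι d + ι b) * (y * ι d′ + ι b′) + ι b * ι b′
        ≈⟨ +-congʳ (*-cong eq eq′) ⟩
      ι a * ι a′ + ι b * ι b′
        ≈⟨ trans (ι-+ (a ℕ.* a′) _) (+-cong (ι-* a a′) (ι-* b b′)) ⟨
      ι (a ℕ.* a′ ℕ.+ b ℕ.* b′) ∎)

  inPrimeField-neg : ∀ {x} → InPrimeField x → InPrimeField (- x)
  inPrimeField-neg {x} (a , b , d , d≉0 , eq) = b , a , d , d≉0 , (begin
    - x * ι d + ι a                ≈⟨ +-cong (-‿distribˡ-* x (ι d)) eq ⟨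
    - (x * ι d) + (x * ι d + ι b)  ≈⟨ +-assoc _ _ _ ⟨
    - (x * ι d) + x * ι d + ι b    ≈⟨ +-congʳ (-‿inverseˡ _) ⟩
    0# + ι b                       ≈⟨ +-identityˡ _ ⟩
    ι b                            ∎)

  -- The inverse of `(a - b) / d` is `d / (a - b)`. Denominators are natural numbers, so the sign of
  -- `a - b` is moved into the numerator when `a ≤ b`; a vanishing denominator would make `ι d`
  -- vanish.
  inPrimeField-inverse : ∀ {x y} → x * y ≈ 1# → InPrimeField x → InPrimeField y
  inPrimeField-inverse {x} {y} xy≈1 (a , b , d , d≉0 , eq) = cases (ℕₚ.≤-total b a)
    where
    ya≈d+yb : y * ι a ≈ ι d + y * ι b
    ya≈d+yb = begin
      y * ι a                    ≈⟨ *-congˡ eq ⟨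
      y * (x * ι d + ι b)        ≈⟨ y[xd+b]≈xyd+yb x y (ι d) (ι b) ⟩
      x * y * ι d + y * ι b      ≈⟨ +-congʳ (trans (*-congʳ xy≈1) (*-identityˡ (ι d))) ⟩
      ι d + y * ι b              ∎
    cases : b ℕ.≤ a Data.Sum.⊎ a ℕ.≤ b → InPrimeField y
    cases (inj₁ b≤a) = d , 0 , a ℕ.∸ b , (λ q≈0 → d≉0 (trans (sym yq≈d) (trans (*-congˡ q≈0) (zeroʳ y)))) , trans (+-identityʳ _) yq≈d
      where
      yq≈d : y * ι (a ℕ.∸ b) ≈ ι d
      yq≈d = +-cancelˡ (y * ι b) _ _ (begin
        y * ι b + y * ι (a ℕ.∸ b)    ≈⟨ distribˡ y _ _ ⟨
        y * (ι b + ι (a ℕ.∸ b))      ≈⟨ *-congˡ (ι-∸ b≤a) ⟨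
        y * ι a                      ≈⟨ ya≈d+yb ⟩
        ι d + y * ι b                ≈⟨ +-comm _ _ ⟩
        y * ι b + ι d                ∎)
    cases (inj₂ a≤b) = 0 , d , b ℕ.∸ a , (λ q≈0 → d≉0 (trans (sym (trans (+-congʳ (trans (*-congˡ q≈0) (zeroʳ y))) (+-identityˡ _))) yq+d≈0)) , yq+d≈0
      where
      yq+d≈0 : y * ι (b ℕ.∸ a) + ι d ≈ 0#
      yq+d≈0 = +-cancelˡ (y * ι a) _ _ (begin
        y * ι a + (y * ι (b ℕ.∸ a) + ι d)    ≈⟨ ya+[yq+d]≈d+y[a+q] y (ι a) (ι (b ℕ.∸ a)) (ι d) ⟩
        ι d + y * (ι a + ι (b ℕ.∸ a))        ≈⟨ +-congˡ (*-congˡ (ι-∸ a≤b)) ⟨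
        ι d + y * ι b                        ≈⟨ ya≈d+yb ⟨
        y * ι a                              ≈⟨ +-identityʳ _ ⟨
        y * ι a + 0#                         ∎)

  inPrimeField-sum : ∀ {n} {f : Fin n → Carrier} → (∀ i → InPrimeField (f i)) → InPrimeField (sum f)
  inPrimeField-sum {zero}  Pf = inPrimeField-0
  inPrimeField-sum {suc n} Pf = inPrimeField-+ (Pf zero) (inPrimeField-sum (Pf ∘ suc))

  ι≟ι : ∀ a b → Dec (ι a ≈ ι b)
  ι≟ι a b with ℕₚ.≤-total a b
  ... | inj₁ a≤b = map′ (λ q≈0 → sym (trans (ι-∸ a≤b) (trans (+-congˡ q≈0) (+-identityʳ _))))
                        (λ a≈b → +-cancelˡ (ι a) _ _ (trans (sym (ι-∸ a≤b)) (trans (sym a≈b) (sym (+-identityʳ _)))))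
                        (ι≟0 (b ℕ.∸ a))
  ... | inj₂ b≤a = map′ (λ q≈0 → trans (ι-∸ b≤a) (trans (+-congˡ q≈0) (+-identityʳ _)))
                        (λ a≈b → +-cancelˡ (ι b) _ _ (trans (sym (ι-∸ b≤a)) (trans a≈b (sym (+-identityʳ _)))))
                        (ι≟0 (a ℕ.∸ b))

  -- Since `ι d` is nonzero, `x` vanishes exactly when `ι a ≈ ι b`, which the characteristic
  -- decides.
  inPrimeField-≟0 : ∀ {x} → InPrimeField x → Dec (x ≈ 0#)
  inPrimeField-≟0 {x} (a , b , d , d≉0 , eq) = map′
    (λ a≈b → x*y≈0⇒y≈0 d≉0 (trans (*-comm _ _) (+-cancelʳ (ι b) _ _ (trans eq (trans a≈b (sym (+-identityˡ _)))))))
    (λ x≈0 → trans (sym eq) (trans (+-congʳ (trans (*-congʳ x≈0) (zeroˡ _))) (+-identityˡ _)))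
    (ι≟ι a b)

  -- Gaussian elimination over the prime subfield.

  -- The left side is a row with pivot-column entry `β`, applied to the back-substituted vector; the
  -- right side is the eliminated row applied to `v`.
  eliminate-row : ∀ {n} (a b v : Fin n → Carrier) α β →
    β * - sum (λ j → a j * v j) + sum (λ j → b j * (α * v j)) ≈ sum (λ j → (α * b j + - (β * a j)) * v j)
  eliminate-row a b v α β = begin
    β * - sum (λ j → a j * v j) + sum (λ j → b j * (α * v j))
      ≈⟨ +-congʳ (trans (sym (-‿distribʳ-* β _)) (trans (-‿distribˡ-* β _) (*-distribˡ-sum (- β) (λ j → a j * v j)))) ⟩
    sum (λ j → - β * (a j * v j)) + sum (λ j → b j * (α * v j))
      ≈⟨ ∑-distrib-+ (λ j → - β * (a j * v j)) (λ j → b j * (α * v j)) ⟨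
    sum (λ j → - β * (a j * v j) + b j * (α * v j))
      ≈⟨ sum-cong (λ j → trans
           (n[av]+b[αv]≈[αb+na]v (- β) (a j) (v j) (b j) α)
           (*-congʳ (+-congˡ (sym (-‿distribˡ-* β (a j)))))) ⟩
    sum (λ j → (α * b j + - (β * a j)) * v j) ∎

  NontrivialKernel : ∀ {R C} → (Fin R → Fin C → Carrier) → Set (c ⊔ ℓ)
  NontrivialKernel {R} {C} A =
    ∃ λ (v : Fin C → Carrier) → (∀ c → InPrimeField (v c)) × (∃ λ c → v c ≉0) × (∀ r → sum (λ c → A r c * v c) ≈ 0#)

  -- Fraction-free elimination: rows are cross-multiplied with the pivot `A zero c` instead of being
  -- divided by it.
  eliminate-column : ∀ {R C} → Fin (suc C) → (Fin (suc R) → Fin (suc C) → Carrier) → Fin R → Fin C → Carrier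
  eliminate-column c A r j = A zero c * A (suc r) (punchIn c j) + - (A (suc r) c * A zero (punchIn c j))

  inPrimeField-insertAt : ∀ {n} {v : Fin n → Carrier} (c : Fin (suc n)) {x} →
    (∀ j → InPrimeField (v j)) → InPrimeField x → ∀ i → InPrimeField (insertAt v c x i)
  inPrimeField-insertAt         zero    Pv Px zero    = Px
  inPrimeField-insertAt         zero    Pv Px (suc i) = Pv i
  inPrimeField-insertAt {suc n} (suc c) Pv Px zero    = Pv zero
  inPrimeField-insertAt {suc n} (suc c) Pv Px (suc i) = inPrimeField-insertAt c (Pv ∘ suc) Px i

  -- The solution `w` is scaled by the pivot `α`, and column `c` receives `- S`, which makes the
  -- first row cancel. It stays nonzero because `α` is.
  back-substitute : ∀ {R C} (A : Fin (suc R) → Fin (suc C) → Carrier) → (∀ r c → InPrimeField (A r c)) →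
    ∀ c → A zero c ≉0 → NontrivialKernel (eliminate-column c A) → NontrivialKernel A
  back-substitute {R} {C} A PA c α≉0 (w , Pw , (i , wi≉0) , Bw≈0) = v , Pv , (punchIn c i , v≉0) , rows
    where
    α : Carrier
    α = A zero c
    a : Fin C → Carrier
    a j = A zero (punchIn c j)
    S : Carrier
    S = sum (λ j → a j * w j)
    v : Fin (suc C) → Carrier
    v = insertAt (λ j → α * w j) c (- S)
    Pv : ∀ c′ → InPrimeField (v c′)
    Pv = inPrimeField-insertAt c (λ j → inPrimeField-* (PA zero c) (Pw j))
           (inPrimeField-neg (inPrimeField-sum (λ j → inPrimeField-* (PA zero (punchIn c j)) (Pw j))))
    v-c : v c ≡ - S
    v-c = insertAt-lookup (λ j → α * w j) c (- S)
    v-punchIn : ∀ j → v (punchIn c j) ≡ α * w j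
    v-punchIn = insertAt-punchIn (λ j → α * w j) c (- S)
    v≉0 : v (punchIn c i) ≉0
    v≉0 v≈0 = *-≉0 α≉0 wi≉0 (trans (reflexive (≡.sym (v-punchIn i))) v≈0)
    row : ∀ r → sum (λ c′ → A r c′ * v c′) ≈ sum (λ j → (α * A r (punchIn c j) + - (A r c * a j)) * w j)
    row r = begin
      sum (λ c′ → A r c′ * v c′)
        ≈⟨ sum-remove {i = c} (λ c′ → A r c′ * v c′) ⟩
      A r c * v c + sum (λ j → A r (punchIn c j) * v (punchIn c j))
        ≈⟨ +-cong (*-congˡ (reflexive v-c)) (sum-cong (λ j → *-congˡ (reflexive (v-punchIn j)))) ⟩
      A r c * - S + sum (λ j → A r (punchIn c j) * (α * w j))
        ≈⟨ eliminate-row a (λ j → A r (punchIn c j)) w α (A r c) ⟩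
      sum (λ j → (α * A r (punchIn c j) + - (A r c * a j)) * w j) ∎
    rows : ∀ r → sum (λ c′ → A r c′ * v c′) ≈ 0#
    rows zero    = trans (row zero) (sum-zero λ j → trans (*-congʳ (-‿inverseʳ (α * a j))) (zeroˡ (w j)))
    rows (suc r) = trans (row (suc r)) (Bw≈0 r)

  -- Induction on the rows: a zero first row is dropped, otherwise a nonzero entry serves as pivot.
  -- The search for a pivot is decidable because all entries lie in the prime subfield.
  kernel : ∀ {R C} (A : Fin R → Fin C → Carrier) → (∀ r c → InPrimeField (A r c)) → R ℕ.< C → NontrivialKernel A
  kernel {zero}  {suc C} A PA R<C = (λ _ → 1#) , (λ _ → inPrimeField-1) , (zero , 1≉0) , λ ()
  kernel {suc R} {suc C} A PA R<C with any? (λ c → ¬? (inPrimeField-≟0 (PA zero c)))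
  ... | no A₀≈0 =
    let v , Pv , v≉0 , Av≈0 = kernel (A ∘ suc) (PA ∘ suc) (ℕₚ.<-trans (ℕₚ.n<1+n R) R<C)
    in v , Pv , v≉0 , λ where
      zero    → sum-zero {f = λ c → A zero c * v c} λ c → trans (*-congʳ (decidable-stable (inPrimeField-≟0 (PA zero c)) (λ ≉0 → A₀≈0 (c , ≉0)))) (zeroˡ _)
      (suc r) → Av≈0 r
  ... | yes (c , α≉0) = back-substitute A PA c α≉0 (kernel (eliminate-column c A)
      (λ r j → inPrimeField-+ (inPrimeField-* (PA zero c) (PA (suc r) (punchIn c j)))
                       (inPrimeField-neg (inPrimeField-* (PA (suc r) c) (PA zero (punchIn c j)))))
      (ℕ.s<s⁻¹ R<C))

  -- The identity matrix and one-sided inverses.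

  δ : ∀ {n} → Fin n → Fin n → Carrier
  δ i j with i ≟ j
  ... | yes _ = 1#
  ... | no  _ = 0#

  δ-diag : ∀ {n} (i : Fin n) → δ i i ≈ 1#
  δ-diag i with i ≟ i
  ... | yes _   = refl
  ... | no  i≢i = ⊥-elim (i≢i ≡.refl)

  δ-off : ∀ {n} {i j : Fin n} → i ≢ j → δ i j ≈ 0#
  δ-off {i = i} {j} i≢j with i ≟ j
  ... | yes i≡j = ⊥-elim (i≢j i≡j)
  ... | no  _   = refl

  inPrimeField-δ : ∀ {n} (i j : Fin n) → InPrimeField (δ i j)
  inPrimeField-δ i j with i ≟ j
  ... | yes _ = inPrimeField-1
  ... | no  _ = inPrimeField-0

  sum-δˡ : ∀ {n} (f : Fin n → Carrier) i → sum (λ j → δ i j * f j) ≈ f i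
  sum-δˡ f i = trans (sum-single _ i (λ j j≢i → trans (*-congʳ (δ-off (j≢i ∘ ≡.sym))) (zeroˡ _)))
                     (trans (*-congʳ (δ-diag i)) (*-identityˡ _))

  sum-δʳ : ∀ {n} (f : Fin n → Carrier) i → sum (λ j → f j * δ j i) ≈ f i
  sum-δʳ f i = trans (sum-single _ i (λ j j≢i → trans (*-congˡ (δ-off j≢i)) (zeroʳ _)))
                     (trans (*-congˡ (δ-diag i)) (*-identityʳ _))

  -- Associativity `x (A y) = (x A) y` for a row vector, a matrix and a column vector.
  sum-assoc : ∀ {k l} (x : Fin k → Carrier) (A : Fin k → Fin l → Carrier) (y : Fin l → Carrier) →
    sum (λ t → x t * sum (λ j → A t j * y j)) ≈ sum (λ j → sum (λ t → x t * A t j) * y j)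
  sum-assoc x A y = begin
    sum (λ t → x t * sum (λ j → A t j * y j))      ≈⟨ sum-cong (λ t → *-distribˡ-sum (x t) (λ j → A t j * y j)) ⟩
    sum (λ t → sum (λ j → x t * (A t j * y j)))    ≈⟨ ∑-comm (λ t j → x t * (A t j * y j)) ⟩
    sum (λ j → sum (λ t → x t * (A t j * y j)))    ≈⟨ sum-cong (λ j → sum-cong (λ t → sym (*-assoc (x t) (A t j) (y j)))) ⟩
    sum (λ j → sum (λ t → x t * A t j * y j))      ≈⟨ sum-cong (λ j → *-distribʳ-sum (y j) (λ t → x t * A t j)) ⟨
    sum (λ j → sum (λ t → x t * A t j) * y j)      ∎

  -- A linear relation between the k + 1 vectors e_u, C_1, ..., C_k of length k
  -- has a nonzero coefficient at e_u, because the C_j are independent.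
  rightInverse⇒leftInverse : ∀ {k} (M C : Fin k → Fin k → Carrier) → (∀ t j → InPrimeField (C t j)) →
    (∀ i j → sum (λ t → M i t * C t j) ≈ δ i j) →
    ∀ t u → sum (λ i → C t i * M i u) ≈ δ t u
  rightInverse⇒leftInverse {k} M C PC MC≈δ t u = conclude (kernel A PA (ℕₚ.n<1+n k))
    where
    A : Fin k → Fin (suc k) → Carrier
    A t zero    = δ t u
    A t (suc j) = C t j
    PA : ∀ t j → InPrimeField (A t j)
    PA t zero    = inPrimeField-δ t u
    PA t (suc j) = PC t j
    conclude : NontrivialKernel A → sum (λ i → C t i * M i u) ≈ δ t u
    conclude (v , _ , v≉0 , Av≈0) = sym (*-cancelʳ β≉0 (begin
      δ t u * β                                ≈⟨ +-inverseˡ-unique _ _ (Av≈0 t) ⟩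
      - sum (λ j → C t j * γ j)                ≈⟨ trans (-‿sum (λ j → C t j * γ j)) (sum-cong neg-term) ⟩
      sum (λ j → C t j * M j u * β)            ≈⟨ *-distribʳ-sum β (λ j → C t j * M j u) ⟨
      sum (λ j → C t j * M j u) * β            ∎))
      where
      β = v zero
      γ = v ∘ suc
      -‿sum : ∀ {n} (f : Fin n → Carrier) → - sum f ≈ sum (λ j → - f j)
      -‿sum f = begin
        - sum f                      ≈⟨ -‿cong (*-identityˡ _) ⟨
        - (1# * sum f)               ≈⟨ -‿distribˡ-* 1# _ ⟩
        - 1# * sum f                 ≈⟨ *-distribˡ-sum (- 1#) f ⟩
        sum (λ j → - 1# * f j)       ≈⟨ sum-cong (λ j → trans (sym (-‿distribˡ-* 1# (f j))) (-‿cong (*-identityˡ _))) ⟩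
        sum (λ j → - f j)            ∎
      -- Multiplying the relation on the left by `M` turns the columns of `C` into unit vectors, so
      -- `γ` is `- β` times column `u` of `M`.
      γ-eq : ∀ i → M i u * β + γ i ≈ 0#
      γ-eq i = begin
        M i u * β + γ i
          ≈⟨ +-cong (*-congʳ (sum-δʳ (M i) u)) (sum-δˡ γ i) ⟨
        sum (λ t → M i t * δ t u) * β + sum (λ j → δ i j * γ j)
          ≈⟨ +-congˡ (sum-cong (λ j → *-congʳ (MC≈δ i j))) ⟨
        sum (λ j → sum (λ t → M i t * A t j) * v j)
          ≈⟨ sum-assoc (M i) A v ⟨
        sum (λ t → M i t * sum (λ j → A t j * v j))
          ≈⟨ sum-zero (λ t → trans (*-congˡ (Av≈0 t)) (zeroʳ _)) ⟩
        0# ∎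
      neg-term : ∀ j → - (C t j * γ j) ≈ C t j * M j u * β
      neg-term j = begin
        - (C t j * γ j)              ≈⟨ -‿distribʳ-* _ _ ⟩
        C t j * - γ j                ≈⟨ *-congˡ (+-inverseˡ-unique _ _ (γ-eq j)) ⟨
        C t j * (M j u * β)          ≈⟨ *-assoc _ _ _ ⟨
        C t j * M j u * β            ∎
      γ≈0 : β ≈ 0# → ∀ j → γ j ≈ 0#
      γ≈0 β≈0 j = trans (sym (trans (+-congʳ (trans (*-congˡ β≈0) (zeroʳ _))) (+-identityˡ _))) (γ-eq j)
      -- If `β` vanished, so would `γ`, and the relation would be trivial.
      β≉0 : β ≉0
      β≉0 β≈0 = v≈0 (proj₁ v≉0) (proj₂ v≉0)
        where
        v≈0 : ∀ j → ¬ (v j ≉0)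
        v≈0 zero    ≉0 = ≉0 β≈0
        v≈0 (suc j) ≉0 = ≉0 (γ≈0 β≈0 j)

-- Evaluation and degree of monomials.

module Monomials {c ℓ} (F : Field c ℓ) where
  open FieldLemmas F

  pow-cong : ∀ {x y} e → x ≈ y → pow F x e ≈ pow F y e
  pow-cong zero    x≈y = refl
  pow-cong (suc e) x≈y = *-cong x≈y (pow-cong e x≈y)

  pow-+ : ∀ x a b → pow F x (a ℕ.+ b) ≈ pow F x a * pow F x b
  pow-+ x zero    b = sym (*-identityˡ _)
  pow-+ x (suc a) b = trans (*-congˡ (pow-+ x a b)) (sym (*-assoc _ _ _))

  evalMono-cong : ∀ {N} (v : Vec ℕ N) {x y : Fin N → Carrier} → (∀ i → x i ≈ y i) → evalMono F v x ≈ evalMono F v y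
  evalMono-cong []      x≈y = refl
  evalMono-cong (e ∷ v) x≈y = *-cong (pow-cong e (x≈y zero)) (evalMono-cong v (x≈y ∘ suc))

  evalPoly-cong : ∀ {N d} (Q : Poly F N d) {x y : Fin N → Carrier} → (∀ i → x i ≈ y i) → evalPoly F Q x ≈ evalPoly F Q y
  evalPoly-cong {N} {d} Q {x} {y} x≈y = begin
    evalPoly F Q x   ≡⟨ sumFin≡sum (term x) ⟩
    sum (term x)     ≈⟨ sum-cong (λ i → *-congˡ (evalMono-cong (lookupᴸ (boxExponents N d) i) x≈y)) ⟩
    sum (term y)     ≡⟨ sumFin≡sum (term y) ⟨
    evalPoly F Q y   ∎
    where
    term : (Fin N → Carrier) → Fin (length (boxExponents N d)) → Carrier
    term x i = Poly.coeffP Q i * evalMono F (lookupᴸ (boxExponents N d) i) x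

  evalMono-* : ∀ {N} (v w : Vec ℕ N) x → evalMono F (zipWith ℕ._+_ v w) x ≈ evalMono F v x * evalMono F w x
  evalMono-* []      []      x = sym (*-identityˡ 1#)
  evalMono-* (a ∷ v) (b ∷ w) x = trans
    (*-cong (pow-+ (x zero) a b) (evalMono-* v w (x ∘ suc)))
    ([ab][cd]≈[ac][bd] _ _ _ _)

  evalMono-0 : ∀ N x → evalMono F (replicate N 0) x ≈ 1#
  evalMono-0 zero    x = refl
  evalMono-0 (suc N) x = trans (*-identityˡ _) (evalMono-0 N (x ∘ suc))

  unitExponent : ∀ {N} → Fin N → Vec ℕ N
  unitExponent zero    = 1 ∷ replicate _ 0
  unitExponent (suc i) = 0 ∷ unitExponent i

  evalMono-unit : ∀ {N} (i : Fin N) x → evalMono F (unitExponent i) x ≈ x i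
  evalMono-unit zero    x = trans (*-cong (*-identityʳ _) (evalMono-0 _ (x ∘ suc))) (*-identityʳ _)
  evalMono-unit (suc i) x = trans (*-identityˡ _) (evalMono-unit i (x ∘ suc))

  open import Algebra.Properties.CommutativeSemigroup ℕₚ.+-commutativeSemigroup using (interchange)

  degree-zipWith : ∀ {N} (v w : Vec ℕ N) → degree (zipWith ℕ._+_ v w) ≡ degree v ℕ.+ degree w
  degree-zipWith []      []      = ≡.refl
  degree-zipWith (a ∷ v) (b ∷ w) = ≡.trans (≡.cong (a ℕ.+ b ℕ.+_) (degree-zipWith v w))
    (interchange a b (degree v) (degree w))

  degree-0 : ∀ N → degree (replicate N 0) ≡ 0
  degree-0 zero    = ≡.refl
  degree-0 (suc N) = degree-0 N

  degree-unit : ∀ {N} (i : Fin N) → degree (unitExponent i) ≡ 1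
  degree-unit {suc N} zero    = ≡.cong suc (degree-0 N)
  degree-unit {suc N} (suc i) = degree-unit i

-- Bihomogeneous functions and algebraic relations between them.

module Bihomogeneous {c ℓ} (F : Field c ℓ) (ι≟0 : ∀ j → Dec (Field._≈_ F (natMul F j) (Field.0# F))) where
  open FieldLemmas F hiding (ι≟0)
  open PrimeSubfield F ι≟0
  open Monomials F

  -- The linear span over the prime subfield; scalars are restricted so that `kernel` applies to the
  -- resulting coordinates. Functions are compared pointwise, hence the equation carried by each
  -- constructor.
  data Span {X : Set c} (G : (X → Carrier) → Set (c ⊔ ℓ)) (f : X → Carrier) : Set (c ⊔ ℓ) where
    generator : G f → Span G f
    null      : (∀ x → f x ≈ 0#) → Span G f
    plus      : ∀ {g h} → Span G g → Span G h → (∀ x → f x ≈ g x + h x) → Span G f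
    scale     : ∀ {a g} → InPrimeField a → Span G g → (∀ x → f x ≈ a * g x) → Span G f

  -- The family `φ` only has to cover the generators; it may be redundant, since coordinates need
  -- not be unique.
  Span-coefficients : ∀ {X : Set c} {G : (X → Carrier) → Set (c ⊔ ℓ)} {S} (φ : Fin S → X → Carrier) →
    (∀ {g} → G g → ∃ λ q → ∀ x → g x ≈ φ q x) →
    ∀ {f} → Span G f →
    ∃ λ (κ : Fin S → Carrier) → (∀ q → InPrimeField (κ q)) × (∀ x → f x ≈ sum (λ q → κ q * φ q x))
  Span-coefficients φ cover (generator Gf) with q , f≈φ ← cover Gf =
    δ q , inPrimeField-δ q , λ x → trans (f≈φ x) (sym (sum-δˡ (λ j → φ j x) q))
  Span-coefficients φ cover (null f≈0) =
    (λ _ → 0#) , (λ _ → inPrimeField-0) , λ x → trans (f≈0 x) (sym (sum-zero (λ q → zeroˡ (φ q x))))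
  Span-coefficients φ cover (plus Sg Sh f≈)
    with κ , Pκ , g≈ ← Span-coefficients φ cover Sg
       | μ , Pμ , h≈ ← Span-coefficients φ cover Sh =
    (λ q → κ q + μ q) , (λ q → inPrimeField-+ (Pκ q) (Pμ q)) , λ x → trans (f≈ x) (trans (+-cong (g≈ x) (h≈ x))
      (trans (sym (∑-distrib-+ (λ q → κ q * φ q x) (λ q → μ q * φ q x))) (sum-cong (λ q → sym (distribʳ (φ q x) (κ q) (μ q))))))
  Span-coefficients φ cover (scale {a} Pa Sg f≈)
    with κ , Pκ , g≈ ← Span-coefficients φ cover Sg =
    (λ q → a * κ q) , (λ q → inPrimeField-* Pa (Pκ q)) , λ x → trans (f≈ x) (trans (*-congˡ (g≈ x))
      (trans (*-distribˡ-sum a (λ q → κ q * φ q x)) (sum-cong (λ q → sym (*-assoc a (κ q) (φ q x))))))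

  Point : ℕ → ℕ → Set c
  Point A B = (Fin A → Carrier) × (Fin B → Carrier)

  bimonomial : ∀ {A B} → Vec ℕ A → Vec ℕ B → Point A B → Carrier
  bimonomial v w (x , y) = evalMono F v x * evalMono F w y

  IsBimonomial : ∀ {A B} → ℕ → ℕ → (Point A B → Carrier) → Set (c ⊔ ℓ)
  IsBimonomial {A} {B} a b f =
    Σ (Vec ℕ A) λ v → Σ (Vec ℕ B) λ w → degree v ≡ a × degree w ≡ b × (∀ z → f z ≈ bimonomial v w z)

  -- A property of functions, not of formal polynomials: it asserts that some representation of
  -- bidegree `(a , b)` exists. Over a finite field a function can have several bidegrees.
  Bihom : ∀ {A B} → ℕ → ℕ → (Point A B → Carrier) → Set (c ⊔ ℓ)
  Bihom a b = Span (IsBimonomial a b)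

  private variable
    A B a b a′ b′ : ℕ

  Bihom-resp-degree : ∀ {f : Point A B → Carrier} → a ≡ a′ → b ≡ b′ → Bihom a b f → Bihom a′ b′ f
  Bihom-resp-degree ≡.refl ≡.refl Sf = Sf

  monomial-* : ∀ {f g : Point A B → Carrier} → IsBimonomial a b f → IsBimonomial a′ b′ g →
    IsBimonomial (a ℕ.+ a′) (b ℕ.+ b′) (λ z → f z * g z)
  monomial-* (v , w , ≡.refl , ≡.refl , f≈) (v′ , w′ , ≡.refl , ≡.refl , g≈) =
    zipWith ℕ._+_ v v′ , zipWith ℕ._+_ w w′ , degree-zipWith v v′ , degree-zipWith w w′ , λ z →
      trans (*-cong (f≈ z) (g≈ z)) (trans ([ab][cd]≈[ac][bd] _ _ _ _)
        (sym (*-cong (evalMono-* v v′ (proj₁ z)) (evalMono-* w w′ (proj₂ z)))))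

  Bihom-* : ∀ {f g : Point A B → Carrier} → Bihom a b f → Bihom a′ b′ g →
    Bihom (a ℕ.+ a′) (b ℕ.+ b′) (λ z → f z * g z)
  Bihom-* (null f≈0) Sg = null λ z → trans (*-congʳ (f≈0 z)) (zeroˡ _)
  Bihom-* (plus S₁ S₂ f≈) Sg = plus (Bihom-* S₁ Sg) (Bihom-* S₂ Sg) λ z → trans (*-congʳ (f≈ z)) (distribʳ _ _ _)
  Bihom-* (scale Pa S f≈) Sg = scale Pa (Bihom-* S Sg) λ z → trans (*-congʳ (f≈ z)) (*-assoc _ _ _)
  Bihom-* (generator m) (generator m′) = generator (monomial-* m m′)
  Bihom-* (generator m) (null g≈0) = null λ z → trans (*-congˡ (g≈0 z)) (zeroʳ _)
  Bihom-* Sf@(generator m) (plus S₁ S₂ g≈) = plus (Bihom-* Sf S₁) (Bihom-* Sf S₂) λ z → trans (*-congˡ (g≈ z)) (distribˡ _ _ _)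
  Bihom-* Sf@(generator m) (scale Pa S g≈) = scale Pa (Bihom-* Sf S) λ z → trans (*-congˡ (g≈ z)) (x[ay]≈a[xy] _ _ _)

  Bihom-1 : Bihom {A} {B} 0 0 (λ _ → 1#)
  Bihom-1 {A} {B} = generator (replicate A 0 , replicate B 0 , degree-0 A , degree-0 B , λ z →
    sym (trans (*-cong (evalMono-0 A (proj₁ z)) (evalMono-0 B (proj₂ z))) (*-identityˡ 1#)))

  Bihom-var₁ : ∀ (i : Fin A) → Bihom {A} {B} 1 0 (λ z → proj₁ z i)
  Bihom-var₁ {A} {B} i = generator (unitExponent i , replicate B 0 , degree-unit i , degree-0 B , λ z →
    sym (trans (*-cong (evalMono-unit i (proj₁ z)) (evalMono-0 B (proj₂ z))) (*-identityʳ _)))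

  Bihom-var₂ : ∀ (i : Fin B) → Bihom {A} {B} 0 1 (λ z → proj₂ z i)
  Bihom-var₂ {B} {A} i = generator (replicate A 0 , unitExponent i , degree-0 A , degree-unit i , λ z →
    sym (trans (*-cong (evalMono-0 A (proj₁ z)) (evalMono-unit i (proj₂ z))) (*-identityˡ _)))

  Bihom-sum : ∀ {n} {f : Fin n → Point A B → Carrier} → (∀ i → Bihom a b (f i)) → Bihom a b (λ z → sum (λ i → f i z))
  Bihom-sum {n = zero}  Sf = null λ _ → refl
  Bihom-sum {n = suc n} Sf = plus (Sf zero) (Bihom-sum (Sf ∘ suc)) λ _ → refl

  Bihom-pow : ∀ {f : Point A B → Carrier} e → Bihom a b f → Bihom (e ℕ.* a) (e ℕ.* b) (λ z → pow F (f z) e)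
  Bihom-pow zero    Sf = Bihom-1
  Bihom-pow (suc e) Sf = Bihom-* Sf (Bihom-pow e Sf)

  Bihom-monomial : ∀ {N} (v : Vec ℕ N) {φ : Fin N → Point A B → Carrier} → (∀ i → Bihom a b (φ i)) →
    Bihom (degree v ℕ.* a) (degree v ℕ.* b) (λ z → evalMono F v (λ i → φ i z))
  Bihom-monomial []      Sφ = Bihom-1
  Bihom-monomial {a = a} {b = b} (e ∷ v) Sφ = Bihom-resp-degree
    (≡.sym (ℕₚ.*-distribʳ-+ a e (degree v))) (≡.sym (ℕₚ.*-distribʳ-+ b e (degree v)))
    (Bihom-* (Bihom-pow e (Sφ zero)) (Bihom-monomial v (Sφ ∘ suc)))

  -- Fixing the degree determines the first exponent in each group of variables, so the size grows
  -- with exponents `A` and `B` although there are `suc A` and `suc B` variables. Members of the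
  -- wrong degree may occur and do no harm to an upper bound.
  bimonomialFamily : ∀ a b → Fin (suc a ℕ.^ A ℕ.* suc b ℕ.^ B) → Point (suc A) (suc B) → Carrier
  bimonomialFamily {A} {B} a b q = bimonomial
    (completedExponent a a A (quotient {suc a ℕ.^ A} (suc b ℕ.^ B) q))
    (completedExponent b b B (remainder {suc a ℕ.^ A} (suc b ℕ.^ B) q))

  bimonomialFamily-covers : ∀ {f : Point (suc A) (suc B) → Carrier} → IsBimonomial a b f →
    ∃ λ q → ∀ z → f z ≈ bimonomialFamily a b q z
  bimonomialFamily-covers {A} {B} {f = f} (v , w , ≡.refl , ≡.refl , f≈)
    with i , v≡ ← completedExponent-surjective A v
       | j , w≡ ← completedExponent-surjective B w =
    combine i j , λ z → trans (f≈ z) (reflexive (≡.cong₂ (λ v w → bimonomial v w z)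
      (≡.sym (≡.trans (≡.cong (completedExponent _ _ A ∘ proj₁) (remQuot-combine i j)) v≡))
      (≡.sym (≡.trans (≡.cong (completedExponent _ _ B ∘ proj₂) (remQuot-combine i j)) w≡))))

  -- Distinct exponent vectors occupy distinct positions in the box, so the nonzero coefficient
  -- `v i₀` cannot be cancelled by another term.
  polyFromTerms : ∀ {N d S} (u : Fin S → Vec ℕ N) → (∀ i → degree (u i) ℕ.≤ d) → (∀ i j → u i ≡ u j → i ≡ j) →
    (v : Fin S → Carrier) → (∃ λ i → v i ≉0) →
    Σ (Poly F N d) λ Q → NonZeroPoly F Q × (∀ x → evalPoly F Q x ≈ sum (λ i → evalMono F (u i) x * v i))
  polyFromTerms {N} {d} {S} u u≤d u-injective v (i₀ , vi₀≉0) = Q , (pos i₀ , Q≉0) , Q-eval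
    where
    box = boxExponents N d
    pos : Fin S → Fin (length box)
    pos i = Any.index (∈-boxExponents⁺ (u i) (u≤d i))
    lookup-pos : ∀ i → lookupᴸ box (pos i) ≡ u i
    lookup-pos i = ≡.sym (lookup-index (∈-boxExponents⁺ (u i) (u≤d i)))
    pos-injective : ∀ i j → pos i ≡ pos j → i ≡ j
    pos-injective i j eq = u-injective i j (≡.trans (≡.sym (lookup-pos i)) (≡.trans (≡.cong (lookupᴸ box) eq) (lookup-pos j)))
    Q : Poly F N d
    Q = poly λ t → sum (λ i → δ t (pos i) * v i)
    Q≉0 : Poly.coeffP Q (pos i₀) ≉0
    Q≉0 Q≈0 = vi₀≉0 (trans (sym (trans
      (sum-single _ i₀ (λ i i≢i₀ → trans (*-congʳ (δ-off (λ eq → i≢i₀ (≡.sym (pos-injective i₀ i eq))))) (zeroˡ _)))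
      (trans (*-congʳ (δ-diag (pos i₀))) (*-identityˡ _)))) Q≈0)
    Q-eval : ∀ x → evalPoly F Q x ≈ sum (λ i → evalMono F (u i) x * v i)
    Q-eval x = begin
      evalPoly F Q x
        ≡⟨ sumFin≡sum (λ t → sum (λ i → δ t (pos i) * v i) * mono t) ⟩
      sum (λ t → sum (λ i → δ t (pos i) * v i) * mono t)
        ≈⟨ sum-cong (λ t → *-comm _ (mono t)) ⟩
      sum (λ t → mono t * sum (λ i → δ t (pos i) * v i))
        ≈⟨ sum-assoc mono (λ t i → δ t (pos i)) v ⟩
      sum (λ i → sum (λ t → mono t * δ t (pos i)) * v i)
        ≈⟨ sum-cong (λ i → *-congʳ (trans (sum-δʳ mono (pos i)) (reflexive (≡.cong (λ w → evalMono F w x) (lookup-pos i))))) ⟩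
      sum (λ i → evalMono F (u i) x * v i) ∎
      where
      mono : Fin (length box) → Carrier
      mono t = evalMono F (lookupᴸ box t) x

  -- There are more monomials of degree d = N e in the N + 1 functions W than
  -- bimonomials of bidegree (d, d r) to express them.
  annihilator : ∀ {r N} → 1 ℕ.≤ A → 1 ℕ.≤ B → A ℕ.+ B ℕ.≤ N →
    (W : Fin N → Point A B → Carrier) → (∀ i → Bihom 1 r (W i)) →
    ∃ λ d → Σ (Poly F N d) λ Q → NonZeroPoly F Q × (∀ z → evalPoly F Q (λ i → W i z) ≈ 0#)
  annihilator {suc A} {suc B} {r} {suc N} _ _ A+B≤N W SW = go (enough-monomials A B r N A+B<N)
    where
    -- The hypothesis reads `suc A + suc B ≤ suc N`: removing two on the left and one on the right
    -- makes it strict.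
    A+B<N : A ℕ.+ B ℕ.< N
    A+B<N = ≡.subst (ℕ._≤ N) (ℕₚ.+-suc A B) (ℕ.s≤s⁻¹ A+B≤N)
    go : (∃ λ e → suc (N ℕ.* e) ℕ.^ A ℕ.* suc (N ℕ.* e ℕ.* r) ℕ.^ B ℕ.< suc e ℕ.^ N) → _
    go (e , few) = d , proj₁ Q , proj₁ (proj₂ Q) , vanishes
      where
      d = N ℕ.* e
      u : Fin (suc e ℕ.^ N) → Vec ℕ (suc N)
      u = completedExponent d e N
      degree-u : ∀ i → degree (u i) ≡ d
      degree-u i = degree-completedExponent e N i ℕₚ.≤-refl
      φ = bimonomialFamily {A} {B} d (d ℕ.* r)
      Bihom-u : ∀ i → Bihom d (d ℕ.* r) (λ z → evalMono F (u i) (λ l → W l z))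
      Bihom-u i = Bihom-resp-degree
        (≡.trans (ℕₚ.*-identityʳ _) (degree-u i)) (≡.cong (ℕ._* r) (degree-u i))
        (Bihom-monomial (u i) SW)
      expansion = λ i → Span-coefficients φ bimonomialFamily-covers (Bihom-u i)
      -- Column `i` holds the coordinates of the `i`-th monomial in the `W l`; by `few` there are
      -- more columns than rows.
      M = λ q i → proj₁ (expansion i) q
      relation = kernel M (λ q i → proj₁ (proj₂ (expansion i)) q) few
      v = proj₁ relation
      Q = polyFromTerms {d = d} u (λ i → ℕₚ.≤-reflexive (degree-u i)) (completedExponent-injective d e N)
            v (proj₁ (proj₂ (proj₂ relation)))
      vanishes : ∀ z → evalPoly F (proj₁ Q) (λ i → W i z) ≈ 0#
      vanishes z = begin
        evalPoly F (proj₁ Q) (λ i → W i z)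
          ≈⟨ proj₂ (proj₂ Q) (λ i → W i z) ⟩
        sum (λ i → evalMono F (u i) (λ l → W l z) * v i)
          ≈⟨ sum-cong (λ i → *-congʳ (trans (proj₂ (proj₂ (expansion i)) z) (sum-cong (λ q → *-comm (M q i) (φ q z))))) ⟩
        sum (λ i → sum (λ q → φ q z * M q i) * v i)
          ≈⟨ sum-assoc (λ q → φ q z) M v ⟨
        sum (λ q → φ q z * sum (λ i → M q i * v i))
          ≈⟨ sum-zero (λ q → trans (*-congˡ (proj₂ (proj₂ (proj₂ relation)) q)) (zeroʳ (φ q z))) ⟩
        0# ∎

-- Lagrange interpolation on the simplex lattice.

module Interpolation {c ℓ} (F : Field c ℓ) (ι≟0 : ∀ j → Dec (Field._≈_ F (natMul F j) (Field.0# F))) where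
  open FieldLemmas F hiding (ι≟0)
  open PrimeSubfield F ι≟0
  open Bihomogeneous F ι≟0

  prodTo : ℕ → (ℕ → Carrier) → Carrier
  prodTo zero    φ = 1#
  prodTo (suc e) φ = φ e * prodTo e φ

  prodBelow : ∀ {n} → Vec ℕ n → (Fin n → ℕ → Carrier) → Carrier
  prodBelow []      φ = 1#
  prodBelow (e ∷ v) φ = prodTo e (φ zero) * prodBelow v (φ ∘ suc)

  prodTo-zero : ∀ {e j} (φ : ℕ → Carrier) → j ℕ.< e → φ j ≈ 0# → prodTo e φ ≈ 0#
  prodTo-zero {suc e} φ j<1+e φj≈0 with ℕₚ.m<1+n⇒m<n∨m≡n j<1+e
  ... | inj₁ j<e    = trans (*-congˡ (prodTo-zero φ j<e φj≈0)) (zeroʳ _)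
  ... | inj₂ ≡.refl = trans (*-congʳ φj≈0) (zeroˡ _)

  prodBelow-zero : ∀ {n} (v : Vec ℕ n) (φ : Fin n → ℕ → Carrier) l {j} →
    j ℕ.< lookup v l → φ l j ≈ 0# → prodBelow v φ ≈ 0#
  prodBelow-zero (e ∷ v) φ zero    j<e φ≈0 = trans (*-congʳ (prodTo-zero (φ zero) j<e φ≈0)) (zeroˡ _)
  prodBelow-zero (e ∷ v) φ (suc l) j<e φ≈0 = trans (*-congˡ (prodBelow-zero v (φ ∘ suc) l j<e φ≈0)) (zeroʳ _)

  module _ {q} (P : Carrier → Set q) (P-1 : P 1#) (P-* : ∀ {x y} → P x → P y → P (x * y)) where

    prodTo-closed : ∀ e {φ} → (∀ {j} → j ℕ.< e → P (φ j)) → P (prodTo e φ)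
    prodTo-closed zero    Pφ = P-1
    prodTo-closed (suc e) Pφ = P-* (Pφ (ℕₚ.n<1+n e)) (prodTo-closed e (Pφ ∘ ℕₚ.m<n⇒m<1+n))

    prodBelow-closed : ∀ {n} (v : Vec ℕ n) {φ : Fin n → ℕ → Carrier} →
      (∀ l {j} → j ℕ.< lookup v l → P (φ l j)) → P (prodBelow v φ)
    prodBelow-closed []      Pφ = P-1
    prodBelow-closed (e ∷ v) Pφ = P-* (prodTo-closed e (Pφ zero)) (prodBelow-closed v (Pφ ∘ suc))

  Bihom-prodTo : ∀ {A B} e {φ : ℕ → Point A B → Carrier} → (∀ j → Bihom 1 0 (φ j)) →
    Bihom e 0 (λ z → prodTo e (λ j → φ j z))
  Bihom-prodTo zero    Sφ = Bihom-1
  Bihom-prodTo (suc e) Sφ = Bihom-* (Sφ e) (Bihom-prodTo e Sφ)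

  Bihom-prodBelow : ∀ {A B n} (v : Vec ℕ n) {φ : Fin n → ℕ → Point A B → Carrier} → (∀ l j → Bihom 1 0 (φ l j)) →
    Bihom (degree v) 0 (λ z → prodBelow v (λ l j → φ l j z))
  Bihom-prodBelow []      Sφ = Bihom-1
  Bihom-prodBelow (e ∷ v) Sφ = Bihom-* (Bihom-prodTo e (Sφ zero)) (Bihom-prodBelow v (Sφ ∘ suc))

  latticePoint : ∀ {n} → Vec ℕ n → Fin n → Carrier
  latticePoint v l = ι (lookup v l)

  sum-latticePoint : ∀ {n} (v : Vec ℕ n) → sum (latticePoint v) ≈ ι (degree v)
  sum-latticePoint []      = refl
  sum-latticePoint (e ∷ v) = trans (+-congˡ (sum-latticePoint v)) (sym (ι-+ e (degree v)))

  -- The linear form p x_l - j (x_1 + ... + x_n), which is p (b_l - j) at a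
  -- lattice point b of degree p.
  factor : ∀ {n} → ℕ → Fin n → ℕ → (Fin n → Carrier) → Carrier
  factor p l j x = ι p * x l + - ι j * sum x

  factor-latticePoint : ∀ {n p} (b : Vec ℕ n) → degree b ≡ p → ∀ l {j} → j ℕ.≤ lookup b l →
    factor p l j (latticePoint b) ≈ ι p * ι (lookup b l ℕ.∸ j)
  factor-latticePoint {p = p} b ≡.refl l {j} j≤ = begin
    ι p * ι (lookup b l) + - ι j * sum (latticePoint b)
      ≈⟨ +-cong (*-congˡ (ι-∸ j≤)) (*-congˡ (sum-latticePoint b)) ⟩
    ι p * (ι j + ι q) + - ι j * ι p
      ≈⟨ y[x+q]+ny≈[x+n]y+yq (ι p) (ι j) (ι q) (- ι j) ⟩
    (ι j + - ι j) * ι p + ι p * ι q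
      ≈⟨ +-congʳ (trans (*-congʳ (-‿inverseʳ (ι j))) (zeroˡ _)) ⟩
    0# + ι p * ι q
      ≈⟨ +-identityˡ _ ⟩
    ι p * ι q ∎
    where q = lookup b l ℕ.∸ j

  -- Ordinary forms are treated as bihomogeneous functions whose second group of variables is empty.
  Bihom-factor : ∀ {n} p l j → Bihom {n} {0} 1 0 (λ z → factor p l j (proj₁ z))
  Bihom-factor p l j = plus (scale (inPrimeField-ι p) (Bihom-var₁ l) λ _ → refl)
    (scale (inPrimeField-neg (inPrimeField-ι j)) (Bihom-sum Bihom-var₁) λ _ → refl) λ _ → refl

  module _ (n p : ℕ) (invertible : ∀ j → 0 ℕ.< j → j ℕ.≤ p → ι j ≉0) where

    private
      k = dimHom n p

      exponent : Fin k → Vec ℕ n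
      exponent = lookupᴸ (monomials n p)

      point : Fin k → Fin n → Carrier
      point i = latticePoint (exponent i)

      degree-exponent : ∀ i → degree (exponent i) ≡ p
      degree-exponent = degree-lookup-monomials {n} {p}

      -- The unnormalised Lagrange polynomial of the lattice point `a = exponent j`: the product of
      -- the factors for all `l` and all `i < a_l`, hence a form of degree `p`.
      lagrange : Fin k → Point n 0 → Carrier
      lagrange j z = prodBelow (exponent j) (λ l i → factor p l i (proj₁ z))

      -- Another lattice point `b` of the same degree has some `b_l < a_l`, and the factor belonging
      -- to `l` and `b_l` vanishes there.
      lagrange-off : ∀ {i j} → i ≢ j → lagrange j (point i , λ ()) ≈ 0#
      lagrange-off {i} {j} i≢j
        with l , bl<al ← smaller-entry (exponent j) (exponent i)
                           (ℕₚ.≤-reflexive (≡.trans (degree-exponent i) (≡.sym (degree-exponent j))))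
                           (λ eq → i≢j (≡.sym (lookup-injective (monomials-unique n p) j i eq))) =
        prodBelow-zero (exponent j) (λ l e → factor p l e (point i)) l bl<al
          (trans (factor-latticePoint (exponent i) (degree-exponent i) l ℕₚ.≤-refl)
                 (trans (*-congˡ (reflexive (≡.cong ι (ℕₚ.n∸n≡0 (lookup (exponent i) l))))) (zeroʳ _)))

      -- At its own point every factor is `p (a_l - e)` with `0 < a_l - e ≤ p`, and both numbers are
      -- invertible by hypothesis.
      lagrange-diag : ∀ j → InPrimeField (lagrange j (point j , λ ())) × lagrange j (point j , λ ()) ≉0
      lagrange-diag j = prodBelow-closed (λ x → InPrimeField x × x ≉0) (inPrimeField-1 , 1≉0)
        (λ (Px , x≉0) (Py , y≉0) → inPrimeField-* Px Py , *-≉0 x≉0 y≉0) (exponent j) λ l {e} e<al →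
          let eq   = factor-latticePoint (exponent j) (degree-exponent j) l (ℕₚ.<⇒≤ e<al)
              al≤p = ≡.subst (lookup (exponent j) l ℕ.≤_) (degree-exponent j) (lookup≤degree (exponent j) l)
          in inPrimeField-resp (sym eq) (inPrimeField-* (inPrimeField-ι p) (inPrimeField-ι (lookup (exponent j) l ℕ.∸ e))) ,
             λ ≈0 → *-≉0 (invertible p (ℕₚ.<-≤-trans (ℕₚ.≤-<-trans ℕ.z≤n e<al) al≤p) ℕₚ.≤-refl)
                         (invertible (lookup (exponent j) l ℕ.∸ e) (ℕₚ.m<n⇒0<n∸m e<al) (ℕₚ.≤-trans (ℕₚ.m∸n≤m _ e) al≤p))
                         (trans (sym eq) ≈0)

      scaling : ∀ j → ∃ λ y → lagrange j (point j , λ ()) * y ≈ 1#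
      scaling j = inverse _ (proj₂ (lagrange-diag j))

      basis : Fin k → Point n 0 → Carrier
      basis j z = proj₁ (scaling j) * lagrange j z

      Bihom-basis : ∀ j → Bihom p 0 (basis j)
      Bihom-basis j = scale (inPrimeField-inverse (proj₂ (scaling j)) (proj₁ (lagrange-diag j)))
        (Bihom-resp-degree (degree-exponent j) ≡.refl (Bihom-prodBelow (exponent j) (Bihom-factor p))) λ _ → refl

      basis-δ : ∀ i j → basis j (point i , λ ()) ≈ δ i j
      basis-δ i j = by-cases (i ≟ j)
        where
        by-cases : Dec (i ≡ j) → basis j (point i , λ ()) ≈ δ i j
        by-cases (yes ≡.refl) = trans (*-comm _ _) (trans (proj₂ (scaling i)) (sym (δ-diag i)))
        by-cases (no  i≢j)    = trans (*-congˡ (lagrange-off i≢j)) (trans (zeroʳ _) (sym (δ-off i≢j)))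

      monomial : Fin k → Point n 0 → Carrier
      monomial t z = evalMono F (exponent t) (proj₁ z)

      monomial-covers : ∀ {f} → IsBimonomial p 0 f → ∃ λ t → ∀ z → f z ≈ monomial t z
      monomial-covers (v , [] , degree-v , _ , f≈) = Any.index v∈ , λ z →
        trans (f≈ z) (trans (*-identityʳ _) (reflexive (≡.cong (λ w → evalMono F w (proj₁ z)) (lookup-index v∈))))
        where v∈ = ∈-monomials⁺ v degree-v

    -- Column `j` of `C` lists the coefficients of the `j`-th basis form, so evaluation gives
    -- `M C = 1`. The order is then exchanged, because `C M = 1` is what recovers coefficients from
    -- values.
    interpolation : ∃ λ (x : Fin (dimHom n p) → Fin n → Carrier) →
      ∃ λ (C : Fin (dimHom n p) → Fin (dimHom n p) → Carrier) → (∀ t i → InPrimeField (C t i)) ×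
        (∀ t u → sum (λ i → C t i * evalMono F (lookupᴸ (monomials n p) u) (x i)) ≈ δ t u)
    interpolation = point , C , PC , rightInverse⇒leftInverse M C PC MC≈δ
      where
      expansion : ∀ j → _
      expansion j = Span-coefficients monomial monomial-covers (Bihom-basis j)
      C M : Fin k → Fin k → Carrier
      C t j = proj₁ (expansion j) t
      M i t = monomial t (point i , λ ())
      PC : ∀ t j → InPrimeField (C t j)
      PC t j = proj₁ (proj₂ (expansion j)) t
      MC≈δ : ∀ i j → sum (λ t → M i t * C t j) ≈ δ i j
      MC≈δ i j = begin
        sum (λ t → M i t * C t j)      ≈⟨ sum-cong (λ t → *-comm (M i t) (C t j)) ⟩
        sum (λ t → C t j * M i t)      ≈⟨ proj₂ (proj₂ (expansion j)) (point i , λ ()) ⟨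
        basis j (point i , λ ())       ≈⟨ basis-δ i j ⟩
        δ i j                          ∎

-- The exceptional hypersurface.

module Elusive {c ℓ} (F : Field c ℓ) (ι≟0 : ∀ j → Dec (Field._≈_ F (natMul F j) (Field.0# F))) where
  open FieldLemmas F hiding (ι≟0)
  open PrimeSubfield F ι≟0
  open Monomials F
  open Bihomogeneous F ι≟0
  open Interpolation F ι≟0

  coords≡coeff : ∀ {n m p} (P : HomPolyMap F n m p) q →
    coords F P q ≡ HomPolyMap.coeff P (quotient (dimHom n p) q) (remainder {m} (dimHom n p) q)
  coords≡coeff {n} {m} {p} P q with quotRem {m} (dimHom n p) q
  ... | _ , _ = ≡.refl

  evalHom≡sum : ∀ {n m p} (P : HomPolyMap F n m p) x j →
    evalHom F P x j ≡ sum (λ t → HomPolyMap.coeff P j t * evalMono F (lookupᴸ (monomials n p) t) x)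
  evalHom≡sum {n} {m} {p} P x j = sumFin≡sum (λ t → HomPolyMap.coeff P j t * evalMono F (lookupᴸ (monomials n p) t) x)

  -- The sample points and the polynomial `Q` are fixed before `P`. A map `Γ` hitting all sampled
  -- values exhibits `coords F P` as a value of `W′`, where `Q` vanishes. The last hypothesis
  -- compares the coefficients of `Γ` and the coordinates of the preimages with the coefficients of
  -- `P`.
  generically-elusive : ∀ n m p s r → 1 ℕ.≤ n → 1 ℕ.≤ m → 1 ℕ.≤ s →
    (∀ j → 0 ℕ.< j → j ℕ.≤ p → ι j ≉0) →
    m ℕ.* dimHom s r ℕ.+ dimHom n p ℕ.* s ℕ.≤ m ℕ.* dimHom n p →
    GenericallyHolds F n m p (λ P →
      Σ (Fin (dimHom n p) → Fin n → Carrier) (λ x → WeaklyElusive F s r (λ i → evalHom F P (x i))))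
  generically-elusive n m p s r 1≤n 1≤m 1≤s invertible dims = conclude (interpolation n p invertible)
    where
    k D : ℕ
    k = dimHom n p
    D = dimHom s r
    conclude : (∃ λ (x : Fin k → Fin n → Carrier) → ∃ λ (C : Fin k → Fin k → Carrier) → (∀ t i → InPrimeField (C t i)) ×
        (∀ t u → sum (λ i → C t i * evalMono F (lookupᴸ (monomials n p) u) (x i)) ≈ δ t u)) → _
    conclude (x , C , PC , CM≈δ) = d , Q , Q≉0 , λ P QP≉0 → x , λ (Γ , Γ-hits) →
        QP≉0 (trans (evalPoly-cong Q (coords≈W P Γ Γ-hits)) (QW≈0 (parameters Γ (proj₁ ∘ Γ-hits))))
      where
      -- Component `j` of `Γ` at the `i`-th preimage, as a function of the coefficients `g` of `Γ`
      -- and of all preimages `y` jointly.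
      gamma : Fin m → Fin k → Point (m ℕ.* D) (k ℕ.* s) → Carrier
      gamma j i (g , y) = sum (λ u → g (combine j u) * evalMono F (lookupᴸ (monomials s r) u) (λ l → y (combine i l)))
      -- The coefficient that interpolation assigns to these values, a function of bidegree
      -- `(1 , r)`.
      W : Fin m → Fin k → Point (m ℕ.* D) (k ℕ.* s) → Carrier
      W j t z = sum (λ i → C t i * gamma j i z)
      Bihom-W : ∀ j t → Bihom 1 r (W j t)
      Bihom-W j t = Bihom-sum λ i → scale (PC t i)
        (Bihom-sum λ u → Bihom-resp-degree (≡.cong suc (ℕₚ.*-zeroʳ (degree (lookupᴸ (monomials s r) u))))
          (≡.trans (ℕₚ.*-identityʳ _) (degree-lookup-monomials {s} {r} u))
          (Bihom-* (Bihom-var₁ (combine j u)) (Bihom-monomial (lookupᴸ (monomials s r) u) (λ l → Bihom-var₂ (combine i l)))))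
        λ _ → refl
      W′ : Fin (m ℕ.* k) → Point (m ℕ.* D) (k ℕ.* s) → Carrier
      W′ q = W (quotient k q) (remainder {m} k q)
      annihilated = annihilator
        (ℕₚ.*-mono-≤ 1≤m (dimHom-positive s r 1≤s)) (ℕₚ.*-mono-≤ (dimHom-positive n p 1≤n) 1≤s) dims
        W′ (λ q → Bihom-W (quotient k q) (remainder {m} k q))
      d    = proj₁ annihilated
      Q    = proj₁ (proj₂ annihilated)
      Q≉0  = proj₁ (proj₂ (proj₂ annihilated))
      QW≈0 = proj₂ (proj₂ (proj₂ annihilated))

      parameters : (Γ : HomPolyMap F s m r) → (Fin k → Fin s → Carrier) → Point (m ℕ.* D) (k ℕ.* s)
      parameters Γ y = (λ q → HomPolyMap.coeff Γ (quotient D q) (remainder {m} D q)) ,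
                       (λ q → y (quotient s q) (remainder {k} s q))

      gamma≈evalHom : ∀ Γ y j i → gamma j i (parameters Γ y) ≈ evalHom F Γ (y i) j
      gamma≈evalHom Γ y j i = trans
        (sum-cong (λ u → *-cong
          (reflexive (≡.cong (λ (j , u) → HomPolyMap.coeff Γ j u) (remQuot-combine j u)))
          (evalMono-cong (lookupᴸ (monomials s r) u) (λ l → reflexive (≡.cong (λ (i , l) → y i l) (remQuot-combine i l))))))
        (reflexive (≡.sym (evalHom≡sum Γ (y i) j)))

      -- `C` is a left inverse of the evaluation matrix at the sample points.
      coeff-from-values : ∀ (P : HomPolyMap F n m p) j t →
        HomPolyMap.coeff P j t ≈ sum (λ i → C t i * evalHom F P (x i) j)
      coeff-from-values P j t = begin
        v t                                                ≈⟨ sum-δˡ v t ⟨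
        sum (λ u → δ t u * v u)                            ≈⟨ sum-cong (λ u → *-congʳ (CM≈δ t u)) ⟨
        sum (λ u → sum (λ i → C t i * M i u) * v u)        ≈⟨ sum-assoc (C t) M v ⟨
        sum (λ i → C t i * sum (λ u → M i u * v u))        ≈⟨ sum-cong (λ i → *-congˡ (trans (sum-cong (λ u → *-comm (M i u) (v u)))
                                                                 (reflexive (≡.sym (evalHom≡sum P (x i) j))))) ⟩
        sum (λ i → C t i * evalHom F P (x i) j)            ∎
        where
        v : Fin k → Carrier
        v = HomPolyMap.coeff P j
        M : Fin k → Fin k → Carrier
        M i u = evalMono F (lookupᴸ (monomials n p) u) (x i)

      coords≈W : ∀ P Γ (Γ-hits : ∀ i → Σ (Fin s → Carrier) λ y → ∀ j → evalHom F Γ y j ≈ evalHom F P (x i) j) →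
        ∀ q → coords F P q ≈ W′ q (parameters Γ (proj₁ ∘ Γ-hits))
      coords≈W P Γ Γ-hits q = begin
        coords F P q                              ≡⟨ coords≡coeff P q ⟩
        HomPolyMap.coeff P j t                    ≈⟨ coeff-from-values P j t ⟩
        sum (λ i → C t i * evalHom F P (x i) j)   ≈⟨ sum-cong (λ i → *-congˡ (trans (gamma≈evalHom Γ y j i) (proj₂ (Γ-hits i) j))) ⟨
        W′ q (parameters Γ y)                     ∎
        where
        j = quotient k q
        t = remainder {m} k q
        y = proj₁ ∘ Γ-hits

-- The dimension hypothesis in terms of binomial coefficients.

open import Data.Nat using (_+_; _*_; _∸_; _≤_)
open import Data.Nat.Combinatorics using (_C_)

theorem3p10 : ∀ {c ℓ} (F : Field c ℓ) (n m p s r : ℕ) →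
    1 ≤ n → 1 ≤ m → 1 ≤ p → 1 ≤ s → 1 ≤ r → s ≤ m ∸ 1 →
    m * ((s + r ∸ 1) C r) ≤ ((n + p ∸ 1) C p) * (m ∸ s) →
    Σ ℕ (λ ch → HasCharacteristic F ch × (ch ≡ 0 ⊎ p ≤ ch ∸ 1)) →
    GenericallyHolds F n m p (λ P →
    Σ (Fin ((n + p ∸ 1) C p) → Fin n → Field.Carrier F) (λ x →
    WeaklyElusive F s r (λ i → evalHom F P (x i))))
theorem3p10 F (suc n) m p (suc s) r 1≤n 1≤m 1≤p 1≤s 1≤r s≤m-1 bound (ch , char , p<ch) =
  -- With `n` and `s` matched as successors, `n + p ∸ 1` and `s + r ∸ 1` reduce to plain sums; only
  -- the length of the tuple has to be transported.
  ≡.subst (λ k → GenericallyHolds F (suc n) m p (λ P →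
      Σ (Fin k → Fin (suc n) → Field.Carrier F) (λ x → WeaklyElusive F (suc s) r (λ i → evalHom F P (x i)))))
    (dimHom≡C n p)
    (Elusive.generically-elusive F (FieldLemmas.ι≟0 F char) (suc n) m p (suc s) r 1≤n 1≤m 1≤s (invertible char p<ch) dims)
  where
  open Field F using (_≈_; 0#)
  invertible : HasCharacteristic F ch → ch ≡ 0 ⊎ p ≤ ch ∸ 1 → ∀ j → 0 ℕ.< j → j ≤ p → ¬ (natMul F j ≈ 0#)
  invertible (inj₁ (_ , char0))           _             j 0<j _   = char0 j 0<j
  invertible (inj₂ (() , _))              (inj₁ ≡.refl)
  -- Matching on `0 < ch` exposes `ch` as a successor, so `p ≤ ch ∸ 1` gives `j < ch` and minimality
  -- applies.
  invertible (inj₂ (ℕ.s≤s _ , _ , minimal)) (inj₂ p≤ch-1) j 0<j j≤p = minimal j 0<j (ℕ.s≤s (ℕₚ.≤-trans j≤p p≤ch-1))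
  -- Adding `k * suc s` to both sides of `bound` removes the subtraction, since `suc s ≤ m`.
  dims : m * dimHom (suc s) r + dimHom (suc n) p * suc s ≤ m * dimHom (suc n) p
  dims = begin
    m * dimHom (suc s) r + k * suc s       ≡⟨ ≡.cong (λ D → m * D + k * suc s) (dimHom≡C s r) ⟩
    m * ((s + r) C r) + k * suc s          ≤⟨ ℕₚ.+-monoˡ-≤ (k * suc s) bound ⟩
    ((n + p) C p) * (m ∸ suc s) + k * suc s  ≡⟨ ≡.cong (λ K → K * (m ∸ suc s) + k * suc s) (dimHom≡C n p) ⟨
    k * (m ∸ suc s) + k * suc s            ≡⟨ ℕₚ.*-distribˡ-+ k (m ∸ suc s) (suc s) ⟨
    k * (m ∸ suc s + suc s)                ≡⟨ ≡.cong (k *_) (ℕₚ.m∸n+n≡m (ℕₚ.≤-trans s≤m-1 (ℕₚ.m∸n≤m m 1))) ⟩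
    k * m                                  ≡⟨ ℕₚ.*-comm k m ⟩
    m * k                                  ∎
    where
    open ℕₚ.≤-Reasoning
    k = dimHom (suc n) p
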